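{- Let $n\ge1$, $r\ge1$ be integers and let $\lambda(x)=\exp\left(\frac{2\pi\sqrt{ -1}\,ax}{n}\right)$ for some $a\in\mathbb{Z}$, with $d=\gcd(a,n)$ (so $\lambda$ has order $n/d$). Then $$G(\mathrm{SL}_r(\mathbb{Z}_n),\lambda)=n^{\frac{r(r-1)}{2}}d^{\frac{r(r+1)}{2}-1}\prod_{\substack{p\mid n\\ p\nmid n/d}}\prod_{i=2}^r(1-p^{ -i})\cdot K_r(\mathbb{Z}_{n/d},\lambda),$$ where the outer product is over primes $p$.
   Context: $\mathbb{Z}_m=\mathbb{Z}/m\mathbb{Z}$; $\mathrm{SL}_r(\mathbb{Z}_m)$ is the group of $r\times r$ matrices over $\mathbb{Z}_m$ with determinant $1$. $G(\mathrm{SL}_r(\mathbb{Z}_n),\lambda)=\sum_{X\in\mathrm{SL}_r(\mathbb{Z}_n)}\lambda(\mathrm{tr}\,X)$. For an additive character $\mu$ of $\mathbb{Z}_m$, the hyper-Kloosterman sum is $K_r(\mathbb{Z}_m,\mu)=\sum_{x_1,\dots,x_r\in\mathbb{Z}_m,\ x_1\cdots x_r=1}\mu(x_1+\cdots+x_r)$. Here $\lambda$ is regarded as a character of $\mathbb{Z}_{n/d}$ via $\lambda(x\bmod n/d)=\exp\left(\frac{2\pi\sqrt{ -1}(a/d)x}{n/d}\right)$, which is well defined. -}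

module Defs where

open import Level using (Level)
open import Data.Nat as ℕ using (ℕ; zero; suc; _∸_; NonZero)
open import Data.Nat.Divisibility using (_∣_; _∣?_; quotient)
open import Data.Nat.GCD using (gcd; gcd[m,n]∣n)
open import Data.Nat.Primality using (Prime; prime?)
open import Data.Integer as ℤ using (ℤ; ∣_∣)
open import Data.Integer.DivMod using (_%ℕ_)
open import Data.Fin using (Fin; toℕ; punchIn)
open import Data.List using (List; []; _∷_; [_]; map; concatMap; foldr; allFin; upTo; filter)
open import Data.Vec as Vec using (Vec; lookup)
open import Data.Product using (_×_)
import Data.Sum
import Data.Fin
open import Relation.Nullary using (Dec; yes; no; ¬_)
open import Relation.Nullary.Decidable using (_×-dec_; ¬?)
open import Algebra.Bundles using (CommutativeRing)

allVecsOf : {A : Set} → List A → (k : ℕ) → List (Vec A k)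
allVecsOf xs zero    = [ Vec.[] ]
allVecsOf xs (suc k) = concatMap (λ x → map (x Vec.∷_) (allVecsOf xs k)) xs

-- all r×r matrices over ℤ_n (entries represented by Fin n = {0,…,n-1})
Mat : ℕ → ℕ → Set
Mat n r = Vec (Vec (Fin n) r) r

allMats : (n r : ℕ) → List (Mat n r)
allMats n r = allVecsOf (allVecsOf (allFin n) r) r

sumℤ : List ℤ → ℤ
sumℤ = foldr ℤ._+_ (ℤ.+ 0)

prodℤ : List ℤ → ℤ
prodℤ = foldr ℤ._*_ (ℤ.+ 1)

prodℕ : List ℕ → ℕ
prodℕ = foldr ℕ._*_ 1

sumℕ : List ℕ → ℕ
sumℕ = foldr ℕ._+_ 0

sgn : ℕ → ℤ
sgn zero          = ℤ.+ 1
sgn (suc zero)    = ℤ.- (ℤ.+ 1)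
sgn (suc (suc k)) = sgn k

detℤ : (k : ℕ) → (Fin k → Fin k → ℤ) → ℤ
detℤ zero    M = ℤ.+ 1
detℤ (suc k) M =
  sumℤ (map (λ j → sgn (toℕ j) ℤ.* (M Data.Fin.zero j ℤ.* detℤ k (λ i l → M (Data.Fin.suc i) (punchIn j l))))
            (allFin (suc k)))


detLift : {n r : ℕ} → Mat n r → ℤ
detLift {n} {r} X = detℤ r (λ i j → ℤ.+ toℕ (lookup (lookup X i) j))

trLift : {n r : ℕ} → Mat n r → ℕ
trLift {n} {r} X = sumℕ (map (λ i → toℕ (lookup (lookup X i) i)) (allFin r))

≡1mod? : (m : ℕ) (z : ℤ) → Dec (m ∣ ∣ z ℤ.- ℤ.+ 1 ∣)
≡1mod? m z = m ∣? ∣ z ℤ.- ℤ.+ 1 ∣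

module _ {c ℓ : Level} (R : CommutativeRing c ℓ) where
  open CommutativeRing R

  sumR : List Carrier → Carrier
  sumR = foldr _+_ 0#

  powR : Carrier → ℕ → Carrier
  powR x zero    = 1#
  powR x (suc k) = x * powR x k

  ιR : ℕ → Carrier
  ιR zero    = 0#
  ιR (suc k) = 1# + ιR k

  record PrimRootChar0 (n : ℕ) (ζ : Carrier) : Set (c Level.⊔ ℓ) where
    field
      nonzero-ring-char0 : ∀ k → ¬ (ιR (suc k) ≈ 0#)
      no-zero-divisors   : ∀ x y → x * y ≈ 0# → (x ≈ 0#) Data.Sum.⊎ (y ≈ 0#)
      root               : powR ζ n ≈ 1#
      isPrimitive        : ∀ k → 0 ℕ.< k → k ℕ.< n → ¬ (powR ζ k ≈ 1#)

  -- λ(x) = ζ^(a x), a given by its residue aN = a mod n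
  -- G(SL_r(ℤ_n), λ) = Σ_{X ∈ SL_r(ℤ_n)} λ(tr X)
  GaussSL : (n r aN : ℕ) (ζ : Carrier) → Carrier
  GaussSL n r aN ζ =
    sumR (map (λ X → powR ζ (aN ℕ.* trLift X))
              (filter (λ X → ≡1mod? n (detLift X)) (allMats n r)))

  -- K_r(ℤ_m, λ) = Σ_{x ∈ ℤ_m^r, x_1⋯x_r = 1} λ(x_1+⋯+x_r), λ(x mod m) = ζ^(a x)
  Kloost : (m r aN : ℕ) (ζ : Carrier) → Carrier
  Kloost m r aN ζ =
    sumR (map (λ x → powR ζ (aN ℕ.* sumℕ (Vec.toList (Vec.map toℕ x))))
              (filter (λ x → ≡1mod? m (prodℤ (Vec.toList (Vec.map (λ y → ℤ.+ toℕ y) x))))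
                      (allVecsOf (allFin m) r)))

primesDivNotDiv : (n m : ℕ) → List ℕ
primesDivNotDiv n m =
  filter (λ p → prime? p ×-dec (p ∣? n) ×-dec ¬? (p ∣? m)) (upTo (suc n))

twoTo : ℕ → List ℕ
twoTo r = map (λ j → 2 ℕ.+ j) (upTo (r ∸ 1))

-- ∏_p ∏_{i=2}^r p^i   (common denominator of ∏_p ∏_i (1 - p^{-i}))
denomP : (n m r : ℕ) → ℕ
denomP n m r = prodℕ (map (λ p → prodℕ (map (λ i → p ℕ.^ i) (twoTo r))) (primesDivNotDiv n m))

numerP : (n m r : ℕ) → ℕ
numerP n m r = prodℕ (map (λ p → prodℕ (map (λ i → p ℕ.^ i ∸ 1) (twoTo r))) (primesDivNotDiv n m))

{-# OPTIONS --safe #-}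

-- Write T_k(e) for the sum of χ(tr X), χ the character λ, over the k × k matrices X modulo n = d m with e det X ≡ 1,
-- and K_k(e) for the sum of χ(x₁ + ⋯ + x_k) over the x modulo m with e x₁ ⋯ x_k ≡ 1. For e invertible modulo n,
-- T_k(e) is evaluated by induction on k, splitting off the first row (x, v) of X.
-- Adding multiples of the other columns to the first one changes the trace by t · v, so that the matrices with
-- given v contribute 0 unless m ∣ v. If m ∣ v and (x, v) is unimodular modulo n, column operations of this kind
-- make x invertible modulo n without changing x modulo m; then v can be cleared, the trace changing by a
-- multiple of m only, and n^{k-1} χ(x) T_{k-1}(e x) remains, which by induction depends only on x modulo m.
-- The number of unimodular (x, v) with m ∣ v over a given unit modulo m is found by sieving by the primes
-- p ∣ n with p ∤ m, and ∑_x χ(x) K_{k-1}(e x) = K_k(e).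

module Submission where

open import Defs
open import Level using (Level; 0ℓ)
open import Algebra.Bundles using (CommutativeRing)
open import Data.Nat as ℕ using (ℕ; zero; suc; NonZero)
import Data.Nat.Properties as ℕₚ
import Data.Nat.Divisibility as ℕ∣
open import Data.Nat.Divisibility using (_∣_; _∣?_; quotient)
import Data.Nat.DivMod as ℕ/
open import Data.Nat.GCD using (gcd; gcd[m,n]∣m; gcd[m,n]∣n; gcd-greatest; c*gcd[m,n]≡gcd[cm,cn]; module Bézout)
open import Data.Nat.Coprimality using (Coprime; coprime-Bézout; coprime-divisor)
open import Data.Nat.Primality using (Prime; prime?; euclidsLemma; prime⇒nonZero; ¬prime[1]; prime⇒irreducible)
open import Data.Nat.Primality.Factorisation using (factorise; factorisationHasAllPrimeFactors)
open import Data.Nat.ListAction using (product)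
open import Data.Nat.ListAction.Properties using (∈⇒∣product)
import Data.Nat.Tactic.RingSolver as ℕ-Solver
open import Data.Integer as ℤ using (ℤ; +_; -_; -[1+_]; _+_; _*_; _-_; 0ℤ; 1ℤ; ∣_∣)
import Data.Integer.Properties as ℤₚ
open import Data.Integer.DivMod using (_%ℕ_; _/ℕ_; a≡a%ℕn+[a/ℕn]*n; n%ℕd<d)
open import Data.Integer.Divisibility.Signed using (divides; ∣ᵤ⇒∣; ∣⇒∣ᵤ)
open import Data.Integer.Tactic.RingSolver using (solve-∀)
open import Algebra.Properties.CommutativeSemigroup ℕₚ.*-commutativeSemigroup
  using () renaming (interchange to *-interchange)
open import Data.Fin using (Fin; zero; suc; toℕ; fromℕ<; inject₁; punchIn; punchOut; _≟_)
import Data.Fin.Properties as Finₚ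
open import Data.Fin.Induction using (<-weakInduction)
open import Data.List using (List; []; _∷_; _∷ʳ_; _++_; map; concatMap; filter; allFin; tabulate; upTo)
open import Data.List.Properties
  using (map-tabulate; map-++; map-∘; map-cong; upTo-∷ʳ; map-concatMap; concatMap-map; concatMap-cong)
open import Data.List.Membership.Propositional using (_∈_; lose; find)
open import Data.List.Membership.Propositional.Properties using (∈-filter⁺; ∈-filter⁻; ∈-upTo⁺)
open import Data.List.Relation.Unary.All as ListAll using ([]; _∷_)
import Data.List.Relation.Unary.All.Properties as ListAllₚ
open import Data.List.Relation.Unary.Any as ListAny using (here; there)
open import Data.List.Relation.Unary.AllPairs using ([]; _∷_)
open import Data.List.Relation.Unary.Unique.Propositional using (Unique)
import Data.List.Relation.Unary.Unique.Propositional.Properties as Uniqueₚ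
open import Data.Vec as Vec using (Vec; []; _∷_; lookup)
open import Data.Vec.Properties using (lookup-map; lookup-zipWith; lookup-replicate)
open import Data.Vec.Relation.Unary.All as All using (All; []; _∷_)
open import Data.Vec.Relation.Binary.Pointwise.Inductive as Pointwise using (Pointwise; []; _∷_)
open import Data.Product using (∃; ∃₂; _×_; _,_; proj₂)
open import Data.Sum using (_⊎_; inj₁; inj₂; [_,_]′)
open import Function using (_∘_; id)
open import Relation.Binary using (Rel)
open import Relation.Unary using (Pred; Decidable)
open import Relation.Nullary using (Dec; yes; no; ¬_; contradiction)
open import Relation.Nullary.Decidable using (_×-dec_; ¬?; map′)
open import Relation.Binary.PropositionalEquality
  using (_≡_; _≢_; refl; sym; trans; cong; cong₂; subst; module ≡-Reasoning)

-- Determinants and column operations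

-- Only the primes not dividing m have to be sieved out. If p ∣ m divides the row (x, v), then p ∣ e
-- x, no tuple satisfies the condition in K_{k-1}(e x), and the expected value is already 0. The
-- parameter e is forced by the induction: clearing the first row leaves its corner entry as a
-- factor of the determinant. The induction starts at k = 1 because T_0(e) tests e ≡ 1 modulo n,
-- whereas K_0(e) tests it modulo m. Matrices have integer entries, the numbers 0, ..., n - 1
-- representing the residues. A column operation leaves this range, so a change of variables is
-- expressed as equality of sums of functions that respect congruence, and not as a permutation of a
-- list.

SquareMatrix : ℕ → Set
SquareMatrix k = Fin k → Fin k → ℤ

minor : ∀ {k} → Fin (suc k) → SquareMatrix (suc k) → SquareMatrix k
minor j M i l = M (suc i) (punchIn j l)

cofactorTerm : ∀ {k} → SquareMatrix (suc k) → Fin (suc k) → ℤ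
cofactorTerm {k} M j = sgn (toℕ j) * (M zero j * detℤ k (minor j M))

det-expand : ∀ {k} (M : SquareMatrix (suc k)) →
             detℤ (suc k) M ≡ sumℤ (tabulate (cofactorTerm M))
det-expand M = cong sumℤ (map-tabulate id (cofactorTerm M))

module _ (_~_ : Rel ℤ 0ℓ)
         (~-refl : ∀ {x} → x ~ x)
         (+-cong : ∀ {x x′ y y′} → x ~ x′ → y ~ y′ → (x + y) ~ (x′ + y′))
         (*-cong : ∀ {x x′ y y′} → x ~ x′ → y ~ y′ → (x * y) ~ (x′ * y′))
  where

  sum-preserves : ∀ {k} (f g : Fin k → ℤ) → (∀ i → f i ~ g i) →
                  sumℤ (tabulate f) ~ sumℤ (tabulate g)
  sum-preserves {zero}  f g f~g = ~-refl
  sum-preserves {suc k} f g f~g = +-cong (f~g zero) (sum-preserves (λ i → f (suc i)) (λ i → g (suc i)) (λ i → f~g (suc i)))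

  -- Needed for two relations: for `_≡_`, since matrices are functions and are compared entry by
  -- entry, and for congruence modulo N.
  det-preserves : ∀ {k} (M N : SquareMatrix k) → (∀ i j → M i j ~ N i j) →
                  detℤ k M ~ detℤ k N
  det-preserves {zero}  M N M~N = ~-refl
  det-preserves {suc k} M N M~N rewrite det-expand M | det-expand N =
    sum-preserves (cofactorTerm M) (cofactorTerm N) λ j → *-cong {sgn (toℕ j)} ~-refl
      (*-cong (M~N zero j) (det-preserves (minor j M) (minor j N) λ i l → M~N (suc i) (punchIn j l)))

det-cong : ∀ {k} (M N : SquareMatrix k) → (∀ i j → M i j ≡ N i j) → detℤ k M ≡ detℤ k N
det-cong = det-preserves _≡_ refl (cong₂ _+_) (cong₂ _*_)

sum-linear : ∀ {k} (f g h : Fin k → ℤ) t → (∀ i → h i ≡ f i + t * g i) →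
             sumℤ (tabulate h) ≡ sumℤ (tabulate f) + t * sumℤ (tabulate g)
sum-linear {zero}  f g h t eq = sym (trans (ℤₚ.+-identityˡ _) (ℤₚ.*-zeroʳ t))
sum-linear {suc k} f g h t eq = trans
  (cong₂ _+_ (eq zero) (sum-linear (λ i → f (suc i)) (λ i → g (suc i)) (λ i → h (suc i)) t (λ i → eq (suc i))))
  (regroup (f zero) (sumℤ (tabulate (f ∘ suc))) (g zero) (sumℤ (tabulate (g ∘ suc))) t)
  where
  regroup : ∀ a b c d t → (a + t * c) + (b + t * d) ≡ (a + b) + t * (c + d)
  regroup = solve-∀

sum-zero : ∀ {k} (f : Fin k → ℤ) → (∀ i → f i ≡ 0ℤ) → sumℤ (tabulate f) ≡ 0ℤ
sum-zero {zero}  f f≡0 = refl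
sum-zero {suc k} f f≡0 = cong₂ _+_ (f≡0 zero) (sum-zero (λ i → f (suc i)) (λ i → f≡0 (suc i)))

-- In the expansion along the first row, the minor at column a does not contain column a, so the
-- three minors agree there; every other minor contains it, at position `punchOut j≢a`, and the
-- induction applies. Three matrices related entrywise, instead of one with a column replaced, are a
-- form that passes to minors.
det-linear : ∀ {k} (a : Fin k) t (P M N : SquareMatrix k) →
             (∀ i → P i a ≡ M i a + t * N i a) →
             (∀ i j → j ≢ a → P i j ≡ M i j) →
             (∀ i j → j ≢ a → P i j ≡ N i j) →
             detℤ k P ≡ detℤ k M + t * detℤ k N
det-linear {suc k} a t P M N at P≡M P≡N
  rewrite det-expand P | det-expand M | det-expand N =
  sum-linear (cofactorTerm M) (cofactorTerm N) (cofactorTerm P) t term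
  where
  atColumn : ∀ s x t y d → s * ((x + t * y) * d) ≡ s * (x * d) + t * (s * (y * d))
  atColumn = solve-∀
  offColumn : ∀ s x t d e → s * (x * (d + t * e)) ≡ s * (x * d) + t * (s * (x * e))
  offColumn = solve-∀
  term : ∀ j → cofactorTerm P j ≡ cofactorTerm M j + t * cofactorTerm N j
  term j with j ≟ a
  ... | yes refl = begin
    sgn (toℕ j) * (P zero j * detℤ k (minor j P))
      ≡⟨ cong (λ x → sgn (toℕ j) * (x * detℤ k (minor j P))) (at zero) ⟩
    sgn (toℕ j) * ((M zero j + t * N zero j) * detℤ k (minor j P))
      ≡⟨ atColumn (sgn (toℕ j)) (M zero j) t (N zero j) (detℤ k (minor j P)) ⟩
    sgn (toℕ j) * (M zero j * detℤ k (minor j P)) + t * (sgn (toℕ j) * (N zero j * detℤ k (minor j P)))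
      ≡⟨ cong₂ (λ d e → sgn (toℕ j) * (M zero j * d) + t * (sgn (toℕ j) * (N zero j * e)))
               (det-cong (minor j P) (minor j M) λ i l → P≡M (suc i) _ (Finₚ.punchInᵢ≢i j l))
               (det-cong (minor j P) (minor j N) λ i l → P≡N (suc i) _ (Finₚ.punchInᵢ≢i j l)) ⟩
    cofactorTerm M j + t * cofactorTerm N j ∎
    where open ≡-Reasoning
  ... | no j≢a = begin
    sgn (toℕ j) * (P zero j * detℤ k (minor j P))
      ≡⟨ cong (λ d → sgn (toℕ j) * (P zero j * d)) minor-linear ⟩
    sgn (toℕ j) * (P zero j * (detℤ k (minor j M) + t * detℤ k (minor j N)))
      ≡⟨ offColumn (sgn (toℕ j)) (P zero j) t (detℤ k (minor j M)) (detℤ k (minor j N)) ⟩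
    sgn (toℕ j) * (P zero j * detℤ k (minor j M)) + t * (sgn (toℕ j) * (P zero j * detℤ k (minor j N)))
      ≡⟨ cong₂ (λ x y → sgn (toℕ j) * (x * detℤ k (minor j M)) + t * (sgn (toℕ j) * (y * detℤ k (minor j N))))
               (P≡M zero j j≢a) (P≡N zero j j≢a) ⟩
    cofactorTerm M j + t * cofactorTerm N j ∎
    where
    open ≡-Reasoning
    a′ = punchOut j≢a
    off : ∀ l → l ≢ a′ → punchIn j l ≢ a
    off l l≢a′ eq = l≢a′ (Finₚ.punchIn-injective j l a′ (trans eq (sym (Finₚ.punchIn-punchOut j≢a))))
    minor-linear : detℤ k (minor j P) ≡ detℤ k (minor j M) + t * detℤ k (minor j N)
    minor-linear = det-linear a′ t (minor j P) (minor j M) (minor j N)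
      (λ i → subst (λ b → P (suc i) b ≡ M (suc i) b + t * N (suc i) b)
                   (sym (Finₚ.punchIn-punchOut j≢a)) (at (suc i)))
      (λ i l l≢ → P≡M (suc i) _ (off l l≢))
      (λ i l l≢ → P≡N (suc i) _ (off l l≢))

-- Alternation is proved for neighbouring columns first: deleting any third column leaves them
-- neighbours, so the induction through minors goes on. The constructors follow the recursion of
-- `punchIn`.
data Adjacent : ∀ {k} → Fin k → Fin k → Set where
  here  : ∀ {k} → Adjacent {suc (suc k)} zero (suc zero)
  there : ∀ {k} {p q : Fin k} → Adjacent p q → Adjacent (suc p) (suc q)

adjacent-inject₁ : ∀ {k} (i : Fin k) → Adjacent (inject₁ i) (suc i)
adjacent-inject₁ zero    = here
adjacent-inject₁ (suc i) = there (adjacent-inject₁ i)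

adjacent⇒≢ : ∀ {k} {p q : Fin k} → Adjacent p q → q ≢ p
adjacent⇒≢ (there adj) eq = adjacent⇒≢ adj (Finₚ.suc-injective eq)

adjacent-punchIn : ∀ {k} {p q : Fin (suc k)} → Adjacent p q → ∀ l → l ≢ p → l ≢ q →
                   ∃₂ λ p′ q′ → Adjacent p′ q′ × punchIn l p′ ≡ p × punchIn l q′ ≡ q
adjacent-punchIn here zero          l≢p l≢q = contradiction refl l≢p
adjacent-punchIn here (suc zero)    l≢p l≢q = contradiction refl l≢q
adjacent-punchIn {suc (suc k)} here (suc (suc l)) l≢p l≢q = zero , suc zero , here , refl , refl
adjacent-punchIn (there adj) zero   l≢p l≢q = _ , _ , adj , refl , refl
adjacent-punchIn {suc k} (there adj) (suc l) l≢p l≢q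
  with p′ , q′ , adj′ , refl , refl ← adjacent-punchIn adj l (l≢p ∘ cong suc) (l≢q ∘ cong suc)
  = suc p′ , suc q′ , there adj′ , refl , refl

-- Deleting column p or column q leaves the same columns in the same order, except for one place
-- that holds q in the first case and p in the second. When the two columns coincide, so do the two
-- minors.
punchIn-adjacent : ∀ {k} {p q : Fin (suc k)} → Adjacent p q → ∀ l →
                   (punchIn p l ≡ punchIn q l) ⊎ (punchIn p l ≡ q × punchIn q l ≡ p)
punchIn-adjacent here zero          = inj₂ (refl , refl)
punchIn-adjacent here (suc l)       = inj₁ refl
punchIn-adjacent (there adj) zero   = inj₁ refl
punchIn-adjacent (there adj) (suc l) with punchIn-adjacent adj l
... | inj₁ eq        = inj₁ (cong suc eq)
... | inj₂ (eq , eq′) = inj₂ (cong suc eq , cong suc eq′)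

sgn-suc : ∀ k → sgn (suc k) ≡ - sgn k
sgn-suc zero          = refl
sgn-suc (suc zero)    = refl
sgn-suc (suc (suc k)) = sgn-suc k

sgn-adjacent : ∀ {k} {p q : Fin k} → Adjacent p q → sgn (toℕ q) ≡ - sgn (toℕ p)
sgn-adjacent here = refl
sgn-adjacent (there {p = p} {q} adj) = trans (sgn-suc (toℕ q))
  (trans (cong -_ (sgn-adjacent adj)) (cong -_ (sym (sgn-suc (toℕ p)))))

sum-adjacent : ∀ {k} {p q : Fin k} → Adjacent p q → (f : Fin k → ℤ) →
               (∀ l → l ≢ p → l ≢ q → f l ≡ 0ℤ) → f p + f q ≡ 0ℤ →
               sumℤ (tabulate f) ≡ 0ℤ
sum-adjacent here f others pair = begin
  f zero + (f (suc zero) + rest) ≡⟨ sym (ℤₚ.+-assoc (f zero) _ rest) ⟩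
  f zero + f (suc zero) + rest   ≡⟨ cong₂ _+_ pair (sum-zero (λ l → f (suc (suc l))) λ l → others (suc (suc l)) (λ ()) (λ ())) ⟩
  0ℤ ∎
  where
  open ≡-Reasoning
  rest = sumℤ (tabulate (λ l → f (suc (suc l))))
sum-adjacent (there adj) f others pair = cong₂ _+_ (others zero (λ ()) (λ ()))
  (sum-adjacent adj (λ l → f (suc l)) (λ l l≢p l≢q → others (suc l) (l≢p ∘ Finₚ.suc-injective) (l≢q ∘ Finₚ.suc-injective)) pair)

-- The cofactor terms outside the pair vanish by induction; those at p and q have equal entries and
-- minors and opposite signs.
det-adjacent-equal : ∀ {k} {p q : Fin k} → Adjacent p q → (M : SquareMatrix k) →
                     (∀ i → M i p ≡ M i q) → detℤ k M ≡ 0ℤ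
det-adjacent-equal {suc k} {p} {q} adj M p≡q rewrite det-expand M =
  sum-adjacent adj (cofactorTerm M) others pair
  where
  others : ∀ l → l ≢ p → l ≢ q → cofactorTerm M l ≡ 0ℤ
  others l l≢p l≢q with p′ , q′ , adj′ , refl , refl ← adjacent-punchIn adj l l≢p l≢q = begin
    sgn (toℕ l) * (M zero l * detℤ k (minor l M))
      ≡⟨ cong (λ d → sgn (toℕ l) * (M zero l * d)) (det-adjacent-equal adj′ (minor l M) entries) ⟩
    sgn (toℕ l) * (M zero l * 0ℤ) ≡⟨ cong (sgn (toℕ l) *_) (ℤₚ.*-zeroʳ (M zero l)) ⟩
    sgn (toℕ l) * 0ℤ              ≡⟨ ℤₚ.*-zeroʳ (sgn (toℕ l)) ⟩
    0ℤ ∎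
    where
    open ≡-Reasoning
    entries : ∀ i → minor l M i p′ ≡ minor l M i q′
    entries i = p≡q (suc i)
  entries : ∀ i l → M (suc i) (punchIn q l) ≡ M (suc i) (punchIn p l)
  entries i l with punchIn-adjacent adj l
  ... | inj₁ eq         = cong (M (suc i)) (sym eq)
  ... | inj₂ (eq , eq′) rewrite eq | eq′ = p≡q (suc i)
  cancel : ∀ s x → s * x + (- s) * x ≡ 0ℤ
  cancel = solve-∀
  pair : cofactorTerm M p + cofactorTerm M q ≡ 0ℤ
  pair = begin
    cofactorTerm M p + sgn (toℕ q) * (M zero q * detℤ k (minor q M))
      ≡⟨ cong (λ x → cofactorTerm M p + x) (cong₂ _*_ (sgn-adjacent adj)
           (cong₂ _*_ (sym (p≡q zero)) (det-cong (minor q M) (minor p M) entries))) ⟩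
    cofactorTerm M p + (- sgn (toℕ p)) * (M zero p * detℤ k (minor p M))
      ≡⟨ cancel (sgn (toℕ p)) (M zero p * detℤ k (minor p M)) ⟩
    0ℤ ∎
    where open ≡-Reasoning

replaceColumn : ∀ {k} → Fin k → (Fin k → ℤ) → SquareMatrix k → SquareMatrix k
replaceColumn a c M i j with j ≟ a
... | yes _ = c i
... | no  _ = M i j

replaceColumn-at : ∀ {k} (a : Fin k) c M i → replaceColumn a c M i a ≡ c i
replaceColumn-at a c M i with a ≟ a
... | yes _  = refl
... | no a≢a = contradiction refl a≢a

replaceColumn-off : ∀ {k} (a : Fin k) c M i {j} → j ≢ a → replaceColumn a c M i j ≡ M i j
replaceColumn-off a c M i {j} j≢a with j ≟ a
... | yes j≡a = contradiction j≡a j≢a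
... | no _    = refl

det-replaceColumn-linear : ∀ {k} (a : Fin k) (M : SquareMatrix k) t (c c′ e : Fin k → ℤ) →
  (∀ i → e i ≡ c i + t * c′ i) →
  detℤ k (replaceColumn a e M) ≡ detℤ k (replaceColumn a c M) + t * detℤ k (replaceColumn a c′ M)
det-replaceColumn-linear a M t c c′ e eq =
  det-linear a t (replaceColumn a e M) (replaceColumn a c M) (replaceColumn a c′ M) at (off c) (off c′)
  where
  at : ∀ i → replaceColumn a e M i a ≡ replaceColumn a c M i a + t * replaceColumn a c′ M i a
  at i rewrite replaceColumn-at a e M i | replaceColumn-at a c M i | replaceColumn-at a c′ M i = eq i
  off : ∀ c i j → j ≢ a → replaceColumn a e M i j ≡ replaceColumn a c M i j
  off c i j j≢a = trans (replaceColumn-off a e M i j≢a) (sym (replaceColumn-off a c M i j≢a))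

-- Expanding 0 = D(u+v, u+v), where D is the determinant as a function of the two columns.
det-swap-adjacent : ∀ {k} {p q : Fin k} → Adjacent p q → (M M′ : SquareMatrix k) →
                    (∀ i → M′ i p ≡ M i q) → (∀ i → M′ i q ≡ M i p) →
                    (∀ i j → j ≢ p → j ≢ q → M′ i j ≡ M i j) →
                    detℤ k M ≡ - detℤ k M′
det-swap-adjacent {k} {p} {q} adj M M′ atp atq off = begin
  detℤ k M   ≡⟨ det-cong M (rep u v) M≡ ⟩
  D u v      ≡⟨ isolate (D u v) (D v u) ⟩
  D u v + D v u - D v u   ≡⟨ cong (_- D v u) sum≡0 ⟩
  0ℤ - D v u              ≡⟨ ℤₚ.+-identityˡ (- D v u) ⟩
  - D v u                 ≡⟨ cong -_ (sym (det-cong M′ (rep v u) M′≡)) ⟩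
  - detℤ k M′ ∎
  where
  open ≡-Reasoning
  Column = Fin k → ℤ
  u v w : Column
  u i = M i p
  v i = M i q
  -- The factor `1ℤ` gives the sum u + v the shape `_ + t * _` that `det-linear` expects.
  w i = u i + 1ℤ * v i
  rep : Column → Column → SquareMatrix k
  rep c e = replaceColumn p c (replaceColumn q e M)
  D : Column → Column → ℤ
  D c e = detℤ k (rep c e)
  q≢p = adjacent⇒≢ adj
  rep-q : ∀ c e i → rep c e i q ≡ e i
  rep-q c e i = trans (replaceColumn-off p c _ i q≢p) (replaceColumn-at q e M i)
  D-diagonal : ∀ c → D c c ≡ 0ℤ
  D-diagonal c = det-adjacent-equal adj (rep c c) λ i →
    trans (replaceColumn-at p c _ i) (sym (rep-q c c i))
  D-linearˡ : ∀ c → D w c ≡ D u c + 1ℤ * D v c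
  D-linearˡ c = det-replaceColumn-linear p (replaceColumn q c M) 1ℤ u v w λ i → refl
  D-linearʳ : ∀ c → D c w ≡ D c u + 1ℤ * D c v
  D-linearʳ c = det-linear q 1ℤ (rep c w) (rep c u) (rep c v)
    (λ i → trans (rep-q c w i) (sym (cong₂ (λ x y → x + 1ℤ * y) (rep-q c u i) (rep-q c v i))))
    (offq u) (offq v)
    where
    offq : ∀ e i j → j ≢ q → rep c w i j ≡ rep c e i j
    offq e i j j≢q with j ≟ p
    ... | yes refl = refl
    ... | no  _    = trans (replaceColumn-off q w M i j≢q) (sym (replaceColumn-off q e M i j≢q))
  sum≡0 : D u v + D v u ≡ 0ℤ
  sum≡0 = begin
    D u v + D v u  ≡⟨ pad (D u v) (D v u) ⟩
    (0ℤ + 1ℤ * D u v) + 1ℤ * (D v u + 1ℤ * 0ℤ)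
      ≡⟨ cong₂ (λ x y → (x + 1ℤ * D u v) + 1ℤ * (D v u + 1ℤ * y)) (sym (D-diagonal u)) (sym (D-diagonal v)) ⟩
    (D u u + 1ℤ * D u v) + 1ℤ * (D v u + 1ℤ * D v v)
      ≡⟨ cong₂ (λ x y → x + 1ℤ * y) (sym (D-linearʳ u)) (sym (D-linearʳ v)) ⟩
    D u w + 1ℤ * D v w  ≡⟨ sym (D-linearˡ w) ⟩
    D w w               ≡⟨ D-diagonal w ⟩
    0ℤ ∎
    where
    pad : ∀ x y → x + y ≡ (0ℤ + 1ℤ * x) + 1ℤ * (y + 1ℤ * 0ℤ)
    pad = solve-∀
  isolate : ∀ x y → x ≡ x + y - y
  isolate = solve-∀
  M≡ : ∀ i j → M i j ≡ rep u v i j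
  M≡ i j with j ≟ p
  ... | yes refl = refl
  ... | no _ with j ≟ q
  ...   | yes refl = refl
  ...   | no _     = refl
  M′≡ : ∀ i j → M′ i j ≡ rep v u i j
  M′≡ i j with j ≟ p
  ... | yes refl = atp i
  ... | no j≢p with j ≟ q
  ...   | yes refl = atq i
  ...   | no j≢q   = off i j j≢p j≢q

-- Exchanging the copy of the first column with its left neighbour changes only the sign and brings
-- the copy one place closer, until the two are adjacent.
det-first-repeated : ∀ {k} (j : Fin k) (M : SquareMatrix (suc k)) →
                     (∀ i → M i zero ≡ M i (suc j)) → detℤ (suc k) M ≡ 0ℤ
det-first-repeated {suc k} = <-weakInduction
  (λ j → ∀ M → (∀ i → M i zero ≡ M i (suc j)) → detℤ (suc (suc k)) M ≡ 0ℤ)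
  (λ M → det-adjacent-equal here M)
  step
  where
  step : ∀ j → (∀ M → (∀ i → M i zero ≡ M i (suc (inject₁ j))) → detℤ (suc (suc k)) M ≡ 0ℤ) →
         ∀ M → (∀ i → M i zero ≡ M i (suc (suc j))) → detℤ (suc (suc k)) M ≡ 0ℤ
  step j IH M eq = trans
    (det-swap-adjacent adj M M′
      (replaceColumn-at p cq M″)
      (λ i → trans (replaceColumn-off p cq M″ i (adjacent⇒≢ adj)) (replaceColumn-at q cp M i))
      (λ i j j≢p j≢q → trans (replaceColumn-off p cq M″ i j≢p) (replaceColumn-off q cp M i j≢q)))
    (cong -_ (IH M′ λ i → trans (eq i) (sym (replaceColumn-at p cq M″ i))))
    where
    p = suc (inject₁ j)
    q = suc (suc j)
    adj : Adjacent p q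
    adj = there (adjacent-inject₁ j)
    cp cq : Fin (suc (suc k)) → ℤ
    cp i = M i p
    cq i = M i q
    M″ = replaceColumn q cp M
    M′ = replaceColumn p cq M″

-- By linearity in the first column, each added column contributes a multiple of a determinant in
-- which that column occurs twice.
det-first-add : ∀ {k} (t : Fin k → ℤ) (M P : SquareMatrix (suc k)) →
                (∀ i → P i zero ≡ M i zero + sumℤ (tabulate λ j → t j * M i (suc j))) →
                (∀ i j → P i (suc j) ≡ M i (suc j)) →
                detℤ (suc k) P ≡ detℤ (suc k) M
det-first-add {k} t M P at off = trans (det-cong P (replaceColumn zero added M) P≡)
  (trans (combination t (λ j i → M i (suc j)) vanish first)
         (det-cong (replaceColumn zero first M) M M≡))
  where
  open ≡-Reasoning
  first added : Fin (suc k) → ℤ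
  first i = M i zero
  added i = M i zero + sumℤ (tabulate λ j → t j * M i (suc j))
  D : (Fin (suc k) → ℤ) → ℤ
  D c = detℤ (suc k) (replaceColumn zero c M)
  D-cong : ∀ c e → (∀ i → c i ≡ e i) → D c ≡ D e
  D-cong c e c≡e = det-cong (replaceColumn zero c M) (replaceColumn zero e M)
    λ { i zero → c≡e i ; i (suc j) → refl }
  vanish : ∀ j → D (λ i → M i (suc j)) ≡ 0ℤ
  vanish j = det-first-repeated j (replaceColumn zero (λ i → M i (suc j)) M) λ i → refl
  -- The columns w are arbitrary here, so that the induction runs over the number of summands while
  -- the matrix M keeps its size.
  combination : ∀ {l} (t : Fin l → ℤ) (w : Fin l → Fin (suc k) → ℤ) → (∀ j → D (w j) ≡ 0ℤ) →
                ∀ c → D (λ i → c i + sumℤ (tabulate λ j → t j * w j i)) ≡ D c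
  combination {zero}  t w w≡0 c = D-cong (λ i → c i + 0ℤ) c λ i → ℤₚ.+-identityʳ (c i)
  combination {suc l} t w w≡0 c = begin
    D (λ i → c i + (t zero * w zero i + rest i))
      ≡⟨ det-replaceColumn-linear zero M (t zero) (λ i → c i + rest i) (w zero)
           (λ i → c i + (t zero * w zero i + rest i)) (λ i → regroup (c i) (t zero * w zero i) (rest i)) ⟩
    D (λ i → c i + rest i) + t zero * D (w zero)
      ≡⟨ cong₂ _+_ (combination (λ j → t (suc j)) (λ j → w (suc j)) (λ j → w≡0 (suc j)) c) (cong (t zero *_) (w≡0 zero)) ⟩
    D c + t zero * 0ℤ ≡⟨ cong (λ x → D c + x) (ℤₚ.*-zeroʳ (t zero)) ⟩
    D c + 0ℤ          ≡⟨ ℤₚ.+-identityʳ (D c) ⟩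
    D c ∎
    where
    rest : Fin (suc k) → ℤ
    rest i = sumℤ (tabulate λ j → t (suc j) * w (suc j) i)
    regroup : ∀ x y z → x + (y + z) ≡ (x + z) + y
    regroup = solve-∀
  P≡ : ∀ i j → P i j ≡ replaceColumn zero added M i j
  P≡ i zero    = at i
  P≡ i (suc j) = off i j
  M≡ : ∀ i j → replaceColumn zero first M i j ≡ M i j
  M≡ i zero    = refl
  M≡ i (suc j) = refl

-- All columns but the first change at once, while linearity treats one at a time. The matrices
-- `Q s`, where w is cut off after s entries, interpolate; consecutive ones differ by a multiple of
-- a determinant with a repeated column.
det-add-first : ∀ {k} (w : Fin k → ℤ) (M P : SquareMatrix (suc k)) →
                (∀ i → P i zero ≡ M i zero) →
                (∀ i j → P i (suc j) ≡ M i (suc j) + M i zero * w j) →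
                detℤ (suc k) P ≡ detℤ (suc k) M
det-add-first {k} w M P at off = begin
  detℤ (suc k) P     ≡⟨ det-cong P (Q k) P≡ ⟩
  detℤ (suc k) (Q k) ≡⟨ unwind k ℕₚ.≤-refl ⟩
  detℤ (suc k) (Q 0) ≡⟨ det-cong (Q 0) M Q0≡ ⟩
  detℤ (suc k) M ∎
  where
  open ≡-Reasoning
  W : ℕ → Fin k → ℤ
  W s j with toℕ j ℕ.<? s
  ... | yes _ = w j
  ... | no  _ = 0ℤ
  W-in : ∀ s j → toℕ j ℕ.< s → W s j ≡ w j
  W-in s j j<s with toℕ j ℕ.<? s
  ... | yes _  = refl
  ... | no j≮s = contradiction j<s j≮s
  W-out : ∀ s j → s ℕ.≤ toℕ j → W s j ≡ 0ℤ
  W-out s j s≤j with toℕ j ℕ.<? s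
  ... | yes j<s = contradiction s≤j (ℕₚ.<⇒≱ j<s)
  ... | no _    = refl
  Q : ℕ → SquareMatrix (suc k)
  Q s i zero    = M i zero
  Q s i (suc j) = M i (suc j) + M i zero * W s j
  P≡ : ∀ i j → P i j ≡ Q k i j
  P≡ i zero    = at i
  P≡ i (suc j) = trans (off i j) (cong (λ x → M i (suc j) + M i zero * x) (sym (W-in k j (Finₚ.toℕ<n j))))
  drop-term : ∀ x y → x + y * 0ℤ ≡ x
  drop-term = solve-∀
  Q0≡ : ∀ i j → Q 0 i j ≡ M i j
  Q0≡ i zero    = refl
  Q0≡ i (suc j) = drop-term (M i (suc j)) (M i zero)
  unwind : ∀ s → s ℕ.≤ k → detℤ (suc k) (Q s) ≡ detℤ (suc k) (Q 0)
  unwind zero    _   = refl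
  unwind (suc s) s<k = begin
    detℤ (suc k) (Q (suc s)) ≡⟨ det-linear (suc a) (w a) (Q (suc s)) (Q s) N atColumn offColumn offColumn′ ⟩
    detℤ (suc k) (Q s) + w a * detℤ (suc k) N
      ≡⟨ cong (λ x → detℤ (suc k) (Q s) + w a * x)
              (det-first-repeated a N λ i → sym (replaceColumn-at (suc a) (λ i → M i zero) (Q s) i)) ⟩
    detℤ (suc k) (Q s) + w a * 0ℤ ≡⟨ drop-term (detℤ (suc k) (Q s)) (w a) ⟩
    detℤ (suc k) (Q s) ≡⟨ unwind s (ℕₚ.<⇒≤ s<k) ⟩
    detℤ (suc k) (Q 0) ∎
    where
    a = fromℕ< s<k
    toℕ-a : toℕ a ≡ s
    toℕ-a = Finₚ.toℕ-fromℕ< s<k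
    N = replaceColumn (suc a) (λ i → M i zero) (Q s)
    regroup : ∀ x y z → x + y * z ≡ (x + y * 0ℤ) + z * y
    regroup = solve-∀
    atColumn : ∀ i → Q (suc s) i (suc a) ≡ Q s i (suc a) + w a * N i (suc a)
    atColumn i rewrite replaceColumn-at (suc a) (λ i → M i zero) (Q s) i
                     | W-in (suc s) a (ℕₚ.≤-reflexive (cong suc toℕ-a))
                     | W-out s a (ℕₚ.≤-reflexive (sym toℕ-a)) = regroup (M i (suc a)) (M i zero) (w a)
    W-suc : ∀ j → j ≢ a → W (suc s) j ≡ W s j
    W-suc j j≢a with toℕ j ℕ.<? s
    ... | yes j<s = W-in (suc s) j (ℕₚ.m<n⇒m<1+n j<s)
    ... | no j≮s  = W-out (suc s) j (ℕₚ.≤∧≢⇒< (ℕₚ.≮⇒≥ j≮s)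
                      λ s≡j → j≢a (Finₚ.toℕ-injective (trans (sym s≡j) (sym toℕ-a))))
    offColumn : ∀ i j → j ≢ suc a → Q (suc s) i j ≡ Q s i j
    offColumn i zero    _   = refl
    offColumn i (suc j) j≢a = cong (λ x → M i (suc j) + M i zero * x) (W-suc j (j≢a ∘ cong suc))
    offColumn′ : ∀ i j → j ≢ suc a → Q (suc s) i j ≡ N i j
    offColumn′ i j j≢a = trans (offColumn i j j≢a) (sym (replaceColumn-off (suc a) (λ i → M i zero) (Q s) i j≢a))

-- Congruences and sums over residues

infix 4 _≡_[mod_]

-- The quotient is kept as data, so that compatibility with sums and products becomes a polynomial
-- identity for the ring solver.
record _≡_[mod_] (x y : ℤ) (N : ℕ) : Set where
  constructor witness
  field
    multiple : ℤ
    equality : x ≡ y + multiple * + N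

mod-reflexive : ∀ {N x y} → x ≡ y → x ≡ y [mod N ]
mod-reflexive {N} {x} refl = witness 0ℤ (lemma x (+ N))
  where
  lemma : ∀ x n → x ≡ x + 0ℤ * n
  lemma = solve-∀

mod-refl : ∀ {N x} → x ≡ x [mod N ]
mod-refl = mod-reflexive refl

mod-sym : ∀ {N x y} → x ≡ y [mod N ] → y ≡ x [mod N ]
mod-sym {N} {x} {y} (witness q refl) = witness (- q) (lemma y q (+ N))
  where
  lemma : ∀ y q n → y ≡ y + q * n + (- q) * n
  lemma = solve-∀

mod-trans : ∀ {N x y z} → x ≡ y [mod N ] → y ≡ z [mod N ] → x ≡ z [mod N ]
mod-trans {N} {z = z} (witness q refl) (witness q′ refl) = witness (q + q′) (lemma z q q′ (+ N))
  where
  lemma : ∀ z q q′ n → z + q′ * n + q * n ≡ z + (q + q′) * n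
  lemma = solve-∀

mod-+ : ∀ {N x x′ y y′} → x ≡ x′ [mod N ] → y ≡ y′ [mod N ] → x + y ≡ x′ + y′ [mod N ]
mod-+ {N} {x′ = x′} {y′ = y′} (witness q refl) (witness r refl) = witness (q + r) (lemma x′ y′ q r (+ N))
  where
  lemma : ∀ x y q r n → (x + q * n) + (y + r * n) ≡ x + y + (q + r) * n
  lemma = solve-∀

mod-* : ∀ {N x x′ y y′} → x ≡ x′ [mod N ] → y ≡ y′ [mod N ] → x * y ≡ x′ * y′ [mod N ]
mod-* {N} {x′ = x′} {y′ = y′} (witness q refl) (witness r refl) =
  witness (q * y′ + x′ * r + q * + N * r) (lemma x′ y′ q r (+ N))
  where
  lemma : ∀ x y q r n → (x + q * n) * (y + r * n) ≡ x * y + (q * y + x * r + q * n * r) * n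
  lemma = solve-∀

mod-∣ : ∀ {M N x y} → M ℕ∣.∣ N → x ≡ y [mod N ] → x ≡ y [mod M ]
mod-∣ {M} {y = y} (ℕ∣.divides k refl) (witness q refl) = witness (q * + k)
  (trans (cong (λ n → y + q * n) (ℤₚ.pos-* k M)) (lemma y q (+ k) (+ M)))
  where
  lemma : ∀ y q k m → y + q * (k * m) ≡ y + q * k * m
  lemma = solve-∀

∣⇒mod : ∀ {N} x y → N ℕ∣.∣ ∣ x - y ∣ → x ≡ y [mod N ]
∣⇒mod {N} x y N∣ with divides q eq ← ∣ᵤ⇒∣ {+ N} {x - y} N∣ =
  witness q (trans (lemma x y) (cong (λ z → y + z) eq))
  where
  lemma : ∀ x y → x ≡ y + (x - y)
  lemma = solve-∀

mod⇒∣ : ∀ {N x y} → x ≡ y [mod N ] → N ℕ∣.∣ ∣ x - y ∣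
mod⇒∣ {N} {x} {y} (witness q refl) = ∣⇒∣ᵤ {+ N} {x - y} (divides q (lemma y q (+ N)))
  where
  lemma : ∀ y q n → y + q * n - y ≡ q * n
  lemma = solve-∀

∣⇒mod0 : ∀ {N} x → N ℕ∣.∣ ∣ x ∣ → x ≡ 0ℤ [mod N ]
∣⇒mod0 x N∣x = ∣⇒mod x 0ℤ (subst (λ z → _ ℕ∣.∣ ∣ z ∣) (sym (ℤₚ.+-identityʳ x)) N∣x)

mod0⇒∣ : ∀ {N x} → x ≡ 0ℤ [mod N ] → N ℕ∣.∣ ∣ x ∣
mod0⇒∣ {x = x} x≡0 = subst (λ z → _ ℕ∣.∣ ∣ z ∣) (ℤₚ.+-identityʳ x) (mod⇒∣ x≡0)

∣-resp-mod : ∀ {N x y} → x ≡ y [mod N ] → N ℕ∣.∣ ∣ y ∣ → N ℕ∣.∣ ∣ x ∣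
∣-resp-mod {y = y} x≡y N∣y = mod0⇒∣ (mod-trans x≡y (∣⇒mod0 y N∣y))

mod-residue : ∀ N .{{_ : NonZero N}} x → x ≡ + (x %ℕ N) [mod N ]
mod-residue N x = witness (x /ℕ N) (a≡a%ℕn+[a/ℕn]*n x N)

residues : ℕ → List ℤ
residues n = map (λ i → + toℕ i) (allFin n)

-- Finite sums in a commutative ring, and sums over residues

module Summation {c ℓ : Level} (R : CommutativeRing c ℓ) where
  open CommutativeRing R using (Carrier; _≈_; 0#; 1#)
    renaming (_+_ to _⊕_; _*_ to _⊛_)
  private module R = CommutativeRing R
  open import Algebra.Properties.Ring R.ring using (+-cancelʳ)
  open import Algebra.Properties.CommutativeSemigroup R.+-commutativeSemigroup using (interchange)
  open import Algebra.Properties.CommutativeSemigroup R.*-commutativeSemigroup using (x∙yz≈y∙xz)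
  open import Relation.Binary.Reasoning.Setoid R.setoid

  ι : ℕ → Carrier
  ι = ιR R

  ι-+ : ∀ a b → ι (a ℕ.+ b) ≈ ι a ⊕ ι b
  ι-+ zero    b = R.sym (R.+-identityˡ (ι b))
  ι-+ (suc a) b = R.trans (R.+-congˡ (ι-+ a b)) (R.sym (R.+-assoc 1# (ι a) (ι b)))

  ι-* : ∀ a b → ι (a ℕ.* b) ≈ ι a ⊛ ι b
  ι-* zero    b = R.sym (R.zeroˡ (ι b))
  ι-* (suc a) b = begin
    ι (b ℕ.+ a ℕ.* b)          ≈⟨ ι-+ b (a ℕ.* b) ⟩
    ι b ⊕ ι (a ℕ.* b)          ≈⟨ R.+-cong (R.sym (R.*-identityˡ (ι b))) (ι-* a b) ⟩
    1# ⊛ ι b ⊕ ι a ⊛ ι b       ≈⟨ R.sym (R.distribʳ (ι b) 1# (ι a)) ⟩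
    (1# ⊕ ι a) ⊛ ι b           ∎

  ι-1 : ι 1 ≈ 1#
  ι-1 = R.+-identityʳ 1#

  -- Turns the filters of the statement into factors, which can be rewritten by congruences and
  -- moved through sums.
  𝟙 : {P : Set} → Dec P → Carrier
  𝟙 (yes _) = 1#
  𝟙 (no _)  = 0#

  𝟙-cong : {P Q : Set} (p? : Dec P) (q? : Dec Q) → (P → Q) → (Q → P) → 𝟙 p? ≈ 𝟙 q?
  𝟙-cong (yes p) (yes q) P⇒Q Q⇒P = R.refl
  𝟙-cong (yes p) (no ¬q) P⇒Q Q⇒P = contradiction (P⇒Q p) ¬q
  𝟙-cong (no ¬p) (yes q) P⇒Q Q⇒P = contradiction (Q⇒P q) ¬p
  𝟙-cong (no ¬p) (no ¬q) P⇒Q Q⇒P = R.refl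

  𝟙-true : {P : Set} (p? : Dec P) → P → 𝟙 p? ≈ 1#
  𝟙-true (yes _) p = R.refl
  𝟙-true (no ¬p) p = contradiction p ¬p

  𝟙-false : {P : Set} (p? : Dec P) → ¬ P → 𝟙 p? ≈ 0#
  𝟙-false (yes p) ¬p = contradiction p ¬p
  𝟙-false (no _)  ¬p = R.refl

  𝟙-guard : {P : Set} (p? : Dec P) {x y : Carrier} → (P → x ≈ y) → 𝟙 p? ⊛ x ≈ 𝟙 p? ⊛ y
  𝟙-guard (yes p) x≈y = R.*-congˡ (x≈y p)
  𝟙-guard (no _) {x} {y} _ = R.trans (R.zeroˡ x) (R.sym (R.zeroˡ y))

  δ : ℕ → ℤ → Carrier
  δ N z = 𝟙 (N ∣? ∣ z ∣)

  δ-cong : ∀ N {x y} → x ≡ y [mod N ] → δ N x ≈ δ N y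
  δ-cong N {x} {y} x≡y = 𝟙-cong (N ∣? ∣ x ∣) (N ∣? ∣ y ∣) (∣-resp-mod (mod-sym x≡y)) (∣-resp-mod x≡y)

  δ-true : ∀ N z → N ℕ∣.∣ ∣ z ∣ → δ N z ≈ 1#
  δ-true N z = 𝟙-true (N ∣? ∣ z ∣)

  δ-false : ∀ N z → ¬ N ℕ∣.∣ ∣ z ∣ → δ N z ≈ 0#
  δ-false N z = 𝟙-false (N ∣? ∣ z ∣)

  δ-guard : ∀ N z {x y} → (N ℕ∣.∣ ∣ z ∣ → x ≈ y) → δ N z ⊛ x ≈ δ N z ⊛ y
  δ-guard N z = 𝟙-guard (N ∣? ∣ z ∣)

  module _ {A : Set} where

    ∑ : List A → (A → Carrier) → Carrier
    ∑ xs f = sumR R (map f xs)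

    ∑-cong : ∀ xs {f g : A → Carrier} → (∀ x → f x ≈ g x) → ∑ xs f ≈ ∑ xs g
    ∑-cong []       f≈g = R.refl
    ∑-cong (x ∷ xs) f≈g = R.+-cong (f≈g x) (∑-cong xs f≈g)

    ∑-zero : ∀ xs {f : A → Carrier} → (∀ x → f x ≈ 0#) → ∑ xs f ≈ 0#
    ∑-zero []       f≈0 = R.refl
    ∑-zero (x ∷ xs) f≈0 = R.trans (R.+-cong (f≈0 x) (∑-zero xs f≈0)) (R.+-identityˡ 0#)

    ∑-++ : ∀ xs ys (f : A → Carrier) → ∑ (xs ++ ys) f ≈ ∑ xs f ⊕ ∑ ys f
    ∑-++ []       ys f = R.sym (R.+-identityˡ _)
    ∑-++ (x ∷ xs) ys f = R.trans (R.+-congˡ (∑-++ xs ys f)) (R.sym (R.+-assoc _ _ _))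

    ∑-⊕ : ∀ xs (f g : A → Carrier) → ∑ xs (λ x → f x ⊕ g x) ≈ ∑ xs f ⊕ ∑ xs g
    ∑-⊕ []       f g = R.sym (R.+-identityˡ 0#)
    ∑-⊕ (x ∷ xs) f g = R.trans (R.+-congˡ (∑-⊕ xs f g)) (interchange _ _ _ _)

    ∑-*ˡ : ∀ xs c (f : A → Carrier) → c ⊛ ∑ xs f ≈ ∑ xs (λ x → c ⊛ f x)
    ∑-*ˡ []       c f = R.zeroʳ c
    ∑-*ˡ (x ∷ xs) c f = R.trans (R.distribˡ c _ _) (R.+-congˡ (∑-*ˡ xs c f))

    ∑-*ʳ : ∀ xs c (f : A → Carrier) → ∑ xs f ⊛ c ≈ ∑ xs (λ x → f x ⊛ c)
    ∑-*ʳ xs c f = R.trans (R.*-comm _ c) (R.trans (∑-*ˡ xs c f) (∑-cong xs λ x → R.*-comm c _))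

    ∑-filter : ∀ {P : Pred A 0ℓ} (P? : Decidable P) xs (f : A → Carrier) →
               ∑ (filter P? xs) f ≈ ∑ xs (λ x → 𝟙 (P? x) ⊛ f x)
    ∑-filter P? []       f = R.refl
    ∑-filter P? (x ∷ xs) f with P? x
    ... | yes _ = R.+-cong (R.sym (R.*-identityˡ (f x))) (∑-filter P? xs f)
    ... | no  _ = R.trans (∑-filter P? xs f)
                    (R.trans (R.sym (R.+-identityˡ _)) (R.+-congʳ (R.sym (R.zeroˡ (f x)))))

  module _ {A B : Set} where

    ∑-map : ∀ (h : A → B) xs (f : B → Carrier) → ∑ (map h xs) f ≡ ∑ xs (λ x → f (h x))
    ∑-map h xs f = cong (sumR R) (sym (map-∘ xs))

    ∑-concatMap : ∀ (h : A → List B) xs (f : B → Carrier) →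
                  ∑ (concatMap h xs) f ≈ ∑ xs (λ x → ∑ (h x) f)
    ∑-concatMap h []       f = R.refl
    ∑-concatMap h (x ∷ xs) f = R.trans (∑-++ (h x) _ f) (R.+-congˡ (∑-concatMap h xs f))

    ∑-swap : ∀ (xs : List A) (ys : List B) (f : A → B → Carrier) →
             ∑ xs (λ x → ∑ ys (λ y → f x y)) ≈ ∑ ys (λ y → ∑ xs (λ x → f x y))
    ∑-swap []       ys f = R.sym (∑-zero ys λ _ → R.refl)
    ∑-swap (x ∷ xs) ys f = R.trans (R.+-congˡ (∑-swap xs ys f)) (R.sym (∑-⊕ ys (f x) _))

  module _ {A : Set} where

    ∑-allVecs : ∀ (xs : List A) k (f : Vec A (suc k) → Carrier) →
                ∑ (allVecsOf xs (suc k)) f ≈ ∑ xs (λ x → ∑ (allVecsOf xs k) (λ v → f (x ∷ v)))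
    ∑-allVecs xs k f = R.trans (∑-concatMap _ xs f)
      (∑-cong xs λ x → R.reflexive (∑-map (x ∷_) (allVecsOf xs k) f))

  -- A change of variables by h that permutes classes but not the list of representatives: only sums
  -- of functions constant on classes are preserved.
  Invariant : {A : Set} → Rel A 0ℓ → List A → (A → A) → Set (c Level.⊔ ℓ)
  Invariant _∼_ xs h = ∀ f → (∀ {x y} → x ∼ y → f x ≈ f y) → ∑ xs (λ x → f (h x)) ≈ ∑ xs f

  module _ {A : Set} where

    -- A column operation applies one and the same map to each row, so its invariance for rows gives
    -- its invariance for matrices.
    Invariant-map : ∀ {_∼_ : Rel A 0ℓ} → (∀ {x} → x ∼ x) → ∀ {xs h} → Invariant _∼_ xs h →
                    ∀ k → Invariant (Pointwise _∼_) (allVecsOf xs k) (Vec.map h)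
    Invariant-map ∼-refl inv zero f f-resp = R.refl
    Invariant-map ∼-refl {xs} {h} inv (suc k) f f-resp = begin
      ∑ (allVecsOf xs (suc k)) (λ v → f (Vec.map h v))
        ≈⟨ ∑-allVecs xs k _ ⟩
      ∑ xs (λ x → ∑ (allVecsOf xs k) (λ v → f (h x ∷ Vec.map h v)))
        ≈⟨ ∑-cong xs (λ x → Invariant-map ∼-refl inv k (λ v → f (h x ∷ v)) λ v∼w → f-resp (∼-refl ∷ v∼w)) ⟩
      ∑ xs (λ x → ∑ (allVecsOf xs k) (λ v → f (h x ∷ v)))
        ≈⟨ inv _ (λ x∼y → ∑-cong (allVecsOf xs k) λ v → f-resp (x∼y ∷ Pointwise.refl ∼-refl)) ⟩
      ∑ xs (λ x → ∑ (allVecsOf xs k) (λ v → f (x ∷ v)))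
        ≈⟨ R.sym (∑-allVecs xs k f) ⟩
      ∑ (allVecsOf xs (suc k)) f ∎

  module _ {A B : Set} where

    ∑-allVecs-map : ∀ (h : A → B) xs k (f : Vec B k → Carrier) →
                    ∑ (allVecsOf (map h xs) k) f ≈ ∑ (allVecsOf xs k) (λ v → f (Vec.map h v))
    ∑-allVecs-map h xs zero    f = R.refl
    ∑-allVecs-map h xs (suc k) f = begin
      ∑ (allVecsOf (map h xs) (suc k)) f
        ≈⟨ ∑-allVecs (map h xs) k f ⟩
      ∑ (map h xs) (λ x → ∑ (allVecsOf (map h xs) k) (λ v → f (x ∷ v)))
        ≡⟨ ∑-map h xs _ ⟩
      ∑ xs (λ x → ∑ (allVecsOf (map h xs) k) (λ v → f (h x ∷ v)))
        ≈⟨ ∑-cong xs (λ x → ∑-allVecs-map h xs k _) ⟩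
      ∑ xs (λ x → ∑ (allVecsOf xs k) (λ v → f (h x ∷ Vec.map h v)))
        ≈⟨ R.sym (∑-allVecs xs k _) ⟩
      ∑ (allVecsOf xs (suc k)) (λ v → f (Vec.map h v)) ∎

    -- The hypothesis says, in terms of sums, that h is l to one; on vectors of length k it is then
    -- l^k to one.
    ∑-allVecs-fibres : ∀ (ys : List B) (xs : List A) (h : A → B) l →
                       (∀ (f : B → Carrier) → ∑ xs (λ x → f (h x)) ≈ ι l ⊛ ∑ ys f) →
                       ∀ k (f : Vec B k → Carrier) →
                       ∑ (allVecsOf xs k) (λ v → f (Vec.map h v)) ≈ ι (l ℕ.^ k) ⊛ ∑ (allVecsOf ys k) f
    ∑-allVecs-fibres ys xs h l fibre zero    f = R.sym (R.trans (R.*-congʳ ι-1) (R.*-identityˡ _))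
    ∑-allVecs-fibres ys xs h l fibre (suc k) f = begin
      ∑ (allVecsOf xs (suc k)) (λ v → f (Vec.map h v))
        ≈⟨ ∑-allVecs xs k _ ⟩
      ∑ xs (λ x → ∑ (allVecsOf xs k) (λ v → f (h x ∷ Vec.map h v)))
        ≈⟨ fibre (λ y → ∑ (allVecsOf xs k) (λ v → f (y ∷ Vec.map h v))) ⟩
      ι l ⊛ ∑ ys (λ y → ∑ (allVecsOf xs k) (λ v → f (y ∷ Vec.map h v)))
        ≈⟨ R.*-congˡ (∑-cong ys λ y → ∑-allVecs-fibres ys xs h l fibre k (λ v → f (y ∷ v))) ⟩
      ι l ⊛ ∑ ys (λ y → ι (l ℕ.^ k) ⊛ ∑ (allVecsOf ys k) (λ v → f (y ∷ v)))
        ≈⟨ R.*-congˡ (R.sym (∑-*ˡ ys (ι (l ℕ.^ k)) _)) ⟩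
      ι l ⊛ (ι (l ℕ.^ k) ⊛ ∑ ys (λ y → ∑ (allVecsOf ys k) (λ v → f (y ∷ v))))
        ≈⟨ R.sym (R.*-assoc _ _ _) ⟩
      ι l ⊛ ι (l ℕ.^ k) ⊛ ∑ ys (λ y → ∑ (allVecsOf ys k) (λ v → f (y ∷ v)))
        ≈⟨ R.*-cong (R.sym (ι-* l (l ℕ.^ k))) (R.sym (∑-allVecs ys k f)) ⟩
      ι (l ℕ.* l ℕ.^ k) ⊛ ∑ (allVecsOf ys (suc k)) f ∎

  ∑< : ℕ → (ℕ → Carrier) → Carrier
  ∑< zero    f = 0#
  ∑< (suc n) f = f 0 ⊕ ∑< n (λ i → f (suc i))

  ∑<-cong : ∀ n {f g : ℕ → Carrier} → (∀ i → f i ≈ g i) → ∑< n f ≈ ∑< n g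
  ∑<-cong zero    f≈g = R.refl
  ∑<-cong (suc n) f≈g = R.+-cong (f≈g 0) (∑<-cong n λ i → f≈g (suc i))

  ∑<-last : ∀ n f → ∑< (suc n) f ≈ ∑< n f ⊕ f n
  ∑<-last zero    f = R.+-comm (f 0) 0#
  ∑<-last (suc n) f = R.trans (R.+-congˡ (∑<-last n λ i → f (suc i))) (R.sym (R.+-assoc _ _ _))

  -- Adding `f 0` to either side gives the sum of f over 0, ..., n, the last value being equal to
  -- the first.
  ∑<-rotate : ∀ n f → f n ≈ f 0 → ∑< n (λ i → f (suc i)) ≈ ∑< n f
  ∑<-rotate n f fn≈f0 = +-cancelʳ (f 0) _ _ (begin
    ∑< n (λ i → f (suc i)) ⊕ f 0  ≈⟨ R.+-comm _ (f 0) ⟩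
    ∑< (suc n) f                  ≈⟨ ∑<-last n f ⟩
    ∑< n f ⊕ f n                  ≈⟨ R.+-congˡ fn≈f0 ⟩
    ∑< n f ⊕ f 0                  ∎)

  ∑<-+ : ∀ a b f → ∑< (a ℕ.+ b) f ≈ ∑< a f ⊕ ∑< b (λ i → f (a ℕ.+ i))
  ∑<-+ zero    b f = R.sym (R.+-identityˡ _)
  ∑<-+ (suc a) b f = R.trans (R.+-congˡ (∑<-+ a b λ i → f (suc i))) (R.sym (R.+-assoc _ _ _))

  ∑<-* : ∀ q n f → ∑< (q ℕ.* n) f ≈ ∑< q (λ s → ∑< n (λ y → f (s ℕ.* n ℕ.+ y)))
  ∑<-* zero    n f = R.refl
  ∑<-* (suc q) n f = begin
    ∑< (n ℕ.+ q ℕ.* n) f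
      ≈⟨ ∑<-+ n (q ℕ.* n) f ⟩
    ∑< n f ⊕ ∑< (q ℕ.* n) (λ i → f (n ℕ.+ i))
      ≈⟨ R.+-congˡ (∑<-* q n (λ i → f (n ℕ.+ i))) ⟩
    ∑< n f ⊕ ∑< q (λ s → ∑< n (λ y → f (n ℕ.+ (s ℕ.* n ℕ.+ y))))
      ≈⟨ R.+-congˡ (∑<-cong q λ s → ∑<-cong n λ y → R.reflexive (cong f (sym (ℕₚ.+-assoc n (s ℕ.* n) y)))) ⟩
    ∑< n f ⊕ ∑< q (λ s → ∑< n (λ y → f (suc s ℕ.* n ℕ.+ y))) ∎

  ∑<-zero : ∀ n {f} → (∀ i → i ℕ.< n → f i ≈ 0#) → ∑< n f ≈ 0#
  ∑<-zero zero    f≈0 = R.refl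
  ∑<-zero (suc n) f≈0 = R.trans (R.+-cong (f≈0 0 ℕ.z<s) (∑<-zero n λ i i<n → f≈0 (suc i) (ℕ.s<s i<n)))
                                (R.+-identityˡ 0#)

  ∑-residues : ∀ n (f : ℤ → Carrier) → ∑ (residues n) f ≡ ∑< n (λ i → f (+ i))
  ∑-residues n f = trans (∑-map (λ i → + toℕ i) (allFin n) f)
    (trans (cong (sumR R) (map-tabulate {n = n} id (λ i → f (+ toℕ i)))) (tabulated n (λ i → f (+ i))))
    where
    tabulated : ∀ n (g : ℕ → Carrier) → sumR R (tabulate {n = n} (λ i → g (toℕ i))) ≡ ∑< n g
    tabulated zero    g = refl
    tabulated (suc n) g = cong (g 0 ⊕_) (tabulated n λ i → g (suc i))

  Periodic : ℕ → (ℤ → Carrier) → Set ℓ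
  Periodic N f = ∀ {x y} → x ≡ y [mod N ] → f x ≈ f y

  mod-self : ∀ N → + N ≡ 0ℤ [mod N ]
  mod-self N = witness 1ℤ (lemma (+ N))
    where
    lemma : ∀ n → n ≡ 0ℤ + 1ℤ * n
    lemma = solve-∀

  -- Each unit of t is one rotation of the residues, and periodicity closes the cycle.
  ∑-translate-ℕ : ∀ N t → Invariant (_≡_[mod N ]) (residues N) (λ x → x + + t)
  ∑-translate-ℕ N zero    f per = ∑-cong (residues N) λ x → per (mod-reflexive (ℤₚ.+-identityʳ x))
  ∑-translate-ℕ N (suc t) f per = begin
    ∑ (residues N) (λ x → f (x + + suc t))   ≡⟨ ∑-residues N _ ⟩
    ∑< N (λ i → f (+ i + + suc t))           ≈⟨ ∑<-cong N (λ i → R.reflexive (cong f (reassoc i))) ⟩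
    ∑< N (λ i → f (+ suc i + + t))           ≈⟨ ∑<-rotate N (λ i → f (+ i + + t)) (per (mod-+ (mod-self N) (mod-refl {x = + t}))) ⟩
    ∑< N (λ i → f (+ i + + t))               ≡⟨ sym (∑-residues N _) ⟩
    ∑ (residues N) (λ x → f (x + + t))       ≈⟨ ∑-translate-ℕ N t f per ⟩
    ∑ (residues N) f ∎
    where
    reassoc : ∀ i → + i + + suc t ≡ + suc i + + t
    reassoc i = cong +_ (ℕₚ.+-suc i t)

  ∑-translate : ∀ N .{{_ : NonZero N}} t → Invariant (_≡_[mod N ]) (residues N) (λ x → x + t)
  ∑-translate N t f per = R.trans
    (∑-cong (residues N) λ x → per (mod-+ (mod-refl {x = x}) (mod-residue N t)))
    (∑-translate-ℕ N (t %ℕ N) f per)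

  -- Division with remainder: i < q N is i = y + s N with y < N and s < q.
  ∑-residues-* : ∀ q N (f : ℤ → Carrier) →
                 ∑ (residues (q ℕ.* N)) f ≈ ∑ (residues N) (λ y → ∑ (residues q) (λ s → f (y + s * + N)))
  ∑-residues-* q N f = begin
    ∑ (residues (q ℕ.* N)) f                           ≡⟨ ∑-residues (q ℕ.* N) f ⟩
    ∑< (q ℕ.* N) (λ i → f (+ i))                       ≈⟨ ∑<-* q N _ ⟩
    ∑< q (λ s → ∑< N (λ y → f (+ (s ℕ.* N ℕ.+ y))))    ≈⟨ ∑<-cong q (λ s → ∑<-cong N λ y → R.reflexive (cong f (embed s y))) ⟩
    ∑< q (λ s → ∑< N (λ y → f (+ y + + s * + N)))      ≈⟨ ∑<-cong q (λ s → R.reflexive (sym (∑-residues N _))) ⟩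
    ∑< q (λ s → ∑ (residues N) (λ y → f (y + + s * + N)))   ≡⟨ sym (∑-residues q _) ⟩
    ∑ (residues q) (λ s → ∑ (residues N) (λ y → f (y + s * + N))) ≈⟨ ∑-swap (residues q) (residues N) _ ⟩
    ∑ (residues N) (λ y → ∑ (residues q) (λ s → f (y + s * + N))) ∎
    where
    embed : ∀ s y → + (s ℕ.* N ℕ.+ y) ≡ + y + + s * + N
    embed s y = trans (cong +_ (ℕₚ.+-comm (s ℕ.* N) y)) (cong (λ z → + y + z) (ℤₚ.pos-* s N))

  ι-∑ : ∀ N c → ∑ (residues N) (λ _ → c) ≈ ι N ⊛ c
  ι-∑ N c = R.trans (R.reflexive (∑-residues N _)) (go N)
    where
    go : ∀ N → ∑< N (λ _ → c) ≈ ι N ⊛ c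
    go zero    = R.sym (R.zeroˡ c)
    go (suc N) = R.trans (R.+-cong (R.sym (R.*-identityˡ c)) (go N)) (R.sym (R.distribʳ c 1# (ι N)))

  ∑-periodic-* : ∀ q N (f : ℤ → Carrier) → Periodic N f →
                 ∑ (residues (q ℕ.* N)) f ≈ ι q ⊛ ∑ (residues N) f
  ∑-periodic-* q N f per = begin
    ∑ (residues (q ℕ.* N)) f ≈⟨ ∑-residues-* q N f ⟩
    ∑ (residues N) (λ y → ∑ (residues q) (λ s → f (y + s * + N)))
      ≈⟨ ∑-cong (residues N) (λ y → ∑-cong (residues q) λ s → per (witness s refl)) ⟩
    ∑ (residues N) (λ y → ∑ (residues q) (λ _ → f y)) ≈⟨ ∑-cong (residues N) (λ y → ι-∑ q (f y)) ⟩
    ∑ (residues N) (λ y → ι q ⊛ f y)  ≈⟨ R.sym (∑-*ˡ (residues N) (ι q) f) ⟩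
    ι q ⊛ ∑ (residues N) f ∎

  ∑-δ : ∀ N .{{_ : NonZero N}} t → ∑ (residues N) (λ x → δ N (x + t)) ≈ 1#
  ∑-δ (suc N) t = begin
    ∑ (residues (suc N)) (λ x → δ (suc N) (x + t)) ≈⟨ ∑-translate (suc N) t (δ (suc N)) (δ-cong (suc N)) ⟩
    ∑ (residues (suc N)) (δ (suc N))               ≡⟨ ∑-residues (suc N) (δ (suc N)) ⟩
    δ (suc N) 0ℤ ⊕ ∑< N (λ i → δ (suc N) (+ suc i))
      ≈⟨ R.+-cong (δ-true (suc N) 0ℤ (suc N ℕ∣.∣0))
                  (∑<-zero N λ i i<N → δ-false (suc N) (+ suc i) λ N∣i → ℕₚ.<⇒≱ (ℕ.s<s i<N) (ℕ∣.∣⇒≤ N∣i)) ⟩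
    1# ⊕ 0#  ≈⟨ R.+-identityʳ 1# ⟩
    1# ∎

  ∑-δ-* : ∀ q N .{{_ : NonZero N}} t → ∑ (residues (q ℕ.* N)) (λ x → δ N (x + t)) ≈ ι q
  ∑-δ-* q N t = begin
    ∑ (residues (q ℕ.* N)) (λ x → δ N (x + t))
      ≈⟨ ∑-periodic-* q N (λ x → δ N (x + t)) (λ x≡y → δ-cong N (mod-+ x≡y (mod-refl {x = t}))) ⟩
    ι q ⊛ ∑ (residues N) (λ x → δ N (x + t))   ≈⟨ R.*-congˡ (∑-δ N t) ⟩
    ι q ⊛ 1#                                   ≈⟨ R.*-identityʳ (ι q) ⟩
    ι q ∎

  ∑-pick : ∀ N .{{_ : NonZero N}} t (f : ℤ → Carrier) → Periodic N f →
           ∑ (residues N) (λ x → δ N (x - t) ⊛ f x) ≈ f t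
  ∑-pick N t f per = begin
    ∑ (residues N) (λ x → δ N (x - t) ⊛ f x)
      ≈⟨ ∑-cong (residues N) (λ x → δ-guard N (x - t) λ N∣ → per (∣⇒mod x t N∣)) ⟩
    ∑ (residues N) (λ x → δ N (x - t) ⊛ f t)   ≈⟨ R.sym (∑-*ʳ (residues N) (f t) _) ⟩
    ∑ (residues N) (λ x → δ N (x - t)) ⊛ f t   ≈⟨ R.*-congʳ (∑-δ N (- t)) ⟩
    1# ⊛ f t  ≈⟨ R.*-identityˡ (f t) ⟩
    f t ∎

-- Primes, and matrices as vectors of rows

NoCommonPrime : ℕ → ℕ → Set
NoCommonPrime a b = ∀ p → Prime p → p ∣ a → ¬ p ∣ b

prime-divisor : ∀ d .{{_ : NonZero d}} → d ≢ 1 → ∃ λ p → Prime p × p ∣ d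
prime-divisor d d≢1 with factorise d
... | record { factors = [] ; isFactorisation = d≡1 } = contradiction d≡1 d≢1
... | record { factors = p ∷ ps ; isFactorisation = refl ; factorsPrime = prime-p ListAll.∷ _ } =
  p , prime-p , ℕ∣.m∣m*n (product ps)

noCommonPrime⇒coprime : ∀ {a b} .{{_ : NonZero a}} → NoCommonPrime a b → Coprime a b
noCommonPrime⇒coprime ncp {zero} (0∣a , _) = contradiction (ℕ∣.0∣⇒≡0 0∣a) (ℕ.≢-nonZero⁻¹ _)
noCommonPrime⇒coprime ncp {suc d} (d∣a , d∣b) with suc d ℕ.≟ 1
... | yes d≡1 = d≡1
... | no  d≢1 with p , prime-p , p∣d ← prime-divisor (suc d) d≢1 =
  contradiction (ℕ∣.∣-trans p∣d d∣b) (ncp p prime-p (ℕ∣.∣-trans p∣d d∣a))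

prime∣prime : ∀ {p q} → Prime p → Prime q → p ∣ q → p ≡ q
prime∣prime prime-p prime-q p∣q with prime⇒irreducible prime-q p∣q
... | inj₁ refl = contradiction prime-p ¬prime[1]
... | inj₂ p≡q  = p≡q

prime∤1 : ∀ {p} → Prime p → ¬ p ∣ 1
prime∤1 prime-p p∣1 = ¬prime[1] (subst Prime (ℕ∣.∣1⇒≡1 p∣1) prime-p)

noCommonPrime-* : ∀ {a b c} → NoCommonPrime a c → NoCommonPrime b c → NoCommonPrime (a ℕ.* b) c
noCommonPrime-* {a} {b} ncpₐ ncp-b p prime-p p∣ab p∣c with euclidsLemma a b prime-p p∣ab
... | inj₁ p∣a = ncpₐ p prime-p p∣a p∣c
... | inj₂ p∣b = ncp-b p prime-p p∣b p∣c

prime∤⇒noCommonPrime : ∀ {p b} → Prime p → ¬ p ∣ b → NoCommonPrime p b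
prime∤⇒noCommonPrime prime-p p∤b q prime-q q∣p q∣b with refl ← prime∣prime prime-q prime-p q∣p = p∤b q∣b

*-∣-noCommonPrime : ∀ {a b c} .{{_ : NonZero a}} → NoCommonPrime a b → a ∣ c → b ∣ c → b ℕ.* a ∣ c
*-∣-noCommonPrime {a} {b} ncp a∣c (ℕ∣.divides k refl) = subst (_∣ k ℕ.* b) (ℕₚ.*-comm a b)
  (ℕ∣.*-monoˡ-∣ b (coprime-divisor (noCommonPrime⇒coprime ncp) (subst (a ∣_) (ℕₚ.*-comm k b) a∣c)))

Invertible : ℕ → ℤ → Set
Invertible N x = ∃ λ y → y * x ≡ 1ℤ [mod N ]

coprime⇒invertible : ∀ N x → Coprime ∣ x ∣ N → Invertible N x
coprime⇒invertible N (+ a)      cop = invert a (coprime-Bézout cop)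
  where
  invert : ∀ a → Bézout.Identity 1 a N → Invertible N (+ a)
  invert a (Bézout.+- x y eq) = + x , witness (+ y)
    (trans (sym (ℤₚ.pos-* x a)) (trans (cong +_ (sym eq)) (cong (λ z → 1ℤ + z) (ℤₚ.pos-* y N))))
  invert a (Bézout.-+ x y eq) = - + x , witness (- + y)
    (trans (move₁ (+ x) (+ a)) (trans (cong (λ z → 1ℤ - z) eqℤ) (move₂ (+ y) (+ N))))
    where
    eqℤ : 1ℤ + + x * + a ≡ + y * + N
    eqℤ = trans (cong (λ z → 1ℤ + z) (sym (ℤₚ.pos-* x a))) (trans (cong +_ eq) (ℤₚ.pos-* y N))
    move₁ : ∀ x a → - x * a ≡ 1ℤ - (1ℤ + x * a)
    move₁ = solve-∀
    move₂ : ∀ y n → 1ℤ - y * n ≡ 1ℤ + - y * n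
    move₂ = solve-∀
coprime⇒invertible N -[1+ a ] cop with y , inv ← coprime⇒invertible N (+ suc a) cop =
  - y , mod-trans (mod-reflexive (lemma y (+ suc a))) inv
  where
  lemma : ∀ y a → - y * - a ≡ y * a
  lemma = solve-∀

noCommonPrime⇒invertible : ∀ N .{{_ : NonZero N}} x → NoCommonPrime N ∣ x ∣ → Invertible N x
noCommonPrime⇒invertible N x ncp = coprime⇒invertible N x λ (d∣x , d∣N) →
  noCommonPrime⇒coprime ncp (d∣N , d∣x)

invertible-* : ∀ {N x y} → Invertible N x → Invertible N y → Invertible N (x * y)
invertible-* {N} {x} {y} (x′ , inv-x) (y′ , inv-y) = x′ * y′ ,
  mod-trans (mod-reflexive (lemma x x′ y y′)) (mod-* inv-x inv-y)
  where
  lemma : ∀ x x′ y y′ → x′ * y′ * (x * y) ≡ x′ * x * (y′ * y)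
  lemma = solve-∀

-- Divisibility of integer vectors, and shifting an entry to a unit

DividesAll : ∀ {k} → ℕ → Vec ℤ k → Set
DividesAll N v = All (λ x → N ∣ ∣ x ∣) v

dividesAll? : ∀ {k} N (v : Vec ℤ k) → Dec (DividesAll N v)
dividesAll? N = All.all? (λ x → N ∣? ∣ x ∣)

dot : ∀ {k} → Vec ℤ k → Vec ℤ k → ℤ
dot []      []      = 0ℤ
dot (t ∷ ts) (v ∷ vs) = t * v + dot ts vs

dot-zeroˡ : ∀ {k} (v : Vec ℤ k) → dot (Vec.replicate k 0ℤ) v ≡ 0ℤ
dot-zeroˡ []      = refl
dot-zeroˡ (v ∷ vs) = cong₂ _+_ (ℤₚ.*-zeroˡ v) (dot-zeroˡ vs)

dot-mod : ∀ {k N} (t : Vec ℤ k) {v w} → Pointwise (_≡_[mod N ]) v w → dot t v ≡ dot t w [mod N ]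
dot-mod []      []            = mod-refl
dot-mod (t ∷ ts) (v≡w ∷ vs≡ws) = mod-+ (mod-* (mod-refl {x = t}) v≡w) (dot-mod ts vs≡ws)

dividesAll⇒mod0 : ∀ {k N} {v : Vec ℤ k} → DividesAll N v → Pointwise (_≡_[mod N ]) v (Vec.replicate k 0ℤ)
dividesAll⇒mod0 []                     = []
dividesAll⇒mod0 {v = x ∷ _} (N∣x ∷ N∣v) = ∣⇒mod0 x N∣x ∷ dividesAll⇒mod0 N∣v

dot-zeroʳ : ∀ {k} (t : Vec ℤ k) → dot t (Vec.replicate k 0ℤ) ≡ 0ℤ
dot-zeroʳ []       = refl
dot-zeroʳ (t ∷ ts) = cong₂ _+_ (ℤₚ.*-zeroʳ t) (dot-zeroʳ ts)

dot-dividesAll : ∀ {k N} (t : Vec ℤ k) {v} → DividesAll N v → dot t v ≡ 0ℤ [mod N ]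
dot-dividesAll t N∣v = mod-trans (dot-mod t (dividesAll⇒mod0 N∣v)) (mod-reflexive (dot-zeroʳ t))

-- t is the unit vector at the first entry of v that N does not divide. It supplies the column
-- operation under which the sum over x acquires a factor different from 1.
dot-detects : ∀ {k} N (v : Vec ℤ k) → ¬ DividesAll N v → ∃ λ t → ¬ N ∣ ∣ dot t v ∣
dot-detects N [] N∤v = contradiction [] N∤v
dot-detects N (x ∷ v) N∤ with N ∣? ∣ x ∣
... | no N∤x = 1ℤ ∷ Vec.replicate _ 0ℤ ,
  λ N∣ → N∤x (subst (λ z → N ∣ ∣ z ∣) (trans (cong (λ z → 1ℤ * x + z) (dot-zeroˡ v)) (lemma x)) N∣)
  where
  lemma : ∀ x → 1ℤ * x + 0ℤ ≡ x
  lemma = solve-∀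
... | yes N∣x with t , N∤tv ← dot-detects N v (λ N∣v → N∤ (N∣x ∷ N∣v)) =
  0ℤ ∷ t , λ N∣ → N∤tv (subst (λ z → N ∣ ∣ z ∣) (lemma x (dot t v)) N∣)
  where
  lemma : ∀ x y → 0ℤ * x + y ≡ y
  lemma = solve-∀

PrimeDivisor : ℕ → ℕ → Set
PrimeDivisor n p = Prime p × p ∣ n

primeDivisor? : ∀ n p → Dec (PrimeDivisor n p)
primeDivisor? n p = prime? p ×-dec (p ∣? n)

avoidingProduct : ℕ → ℤ → ℕ
avoidingProduct n x = product (filter (λ p → primeDivisor? n p ×-dec ¬? (p ∣? ∣ x ∣)) (upTo (suc n)))

module _ {n} .{{_ : NonZero n}} {x : ℤ} {p} (prime-p : Prime p) where

  private
    select? : ∀ p → Dec (PrimeDivisor n p × ¬ p ∣ ∣ x ∣)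
    select? p = primeDivisor? n p ×-dec ¬? (p ∣? ∣ x ∣)

  ∤⇒∣avoidingProduct : p ∣ n → ¬ p ∣ ∣ x ∣ → p ∣ avoidingProduct n x
  ∤⇒∣avoidingProduct p∣n p∤x = ∈⇒∣product
    (∈-filter⁺ select? (∈-upTo⁺ (ℕ.s≤s (ℕ∣.∣⇒≤ p∣n))) ((prime-p , p∣n) , p∤x))

  -- A prime dividing a product of primes is one of the factors, and these were selected for not
  -- dividing x.
  ∣avoidingProduct⇒∤ : p ∣ avoidingProduct n x → ¬ p ∣ ∣ x ∣
  ∣avoidingProduct⇒∤ p∣Π = proj₂ (proj₂ (∈-filter⁻ select? {xs = upTo (suc n)}
    (factorisationHasAllPrimeFactors prime-p p∣Π
      (ListAll.map (λ { ((prime-q , _) , _) → prime-q }) (ListAllₚ.all-filter select? (upTo (suc n)))))))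

prime∣*⇒ : ∀ {p} → Prime p → ∀ x y → p ∣ ∣ x * y ∣ → (p ∣ ∣ x ∣) ⊎ (p ∣ ∣ y ∣)
prime∣*⇒ {p} prime-p x y p∣xy = euclidsLemma ∣ x ∣ ∣ y ∣ prime-p (subst (p ∣_) (ℤₚ.abs-* x y) p∣xy)

∣-*ˡ : ∀ {N} x y → N ∣ ∣ x ∣ → N ∣ ∣ x * y ∣
∣-*ˡ {N} x y N∣x = subst (N ∣_) (sym (ℤₚ.abs-* x y)) (ℕ∣.∣m⇒∣m*n ∣ y ∣ N∣x)

∣-+-cancelʳ : ∀ {N} x y → N ∣ ∣ x + y ∣ → N ∣ ∣ y ∣ → N ∣ ∣ x ∣
∣-+-cancelʳ {N} x y N∣x+y N∣y =
  ∣-resp-mod {x = x} {x + y} (mod-trans (mod-reflexive (sym (ℤₚ.+-identityʳ x))) (mod-+ (mod-refl {x = x}) (mod-sym (∣⇒mod0 y N∣y)))) N∣x+y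

-- Add to x suitable multiples of the entries of v one at a time. With T = avoidingProduct n x, a prime
-- p ∣ n divides exactly one of x and T, so it divides x + T y only if it divides both x and y.
coprime-shift : ∀ n .{{_ : NonZero n}} {k} x (v : Vec ℤ k) →
                (∀ p → PrimeDivisor n p → ¬ ((p ∣ ∣ x ∣) × DividesAll p v)) →
                ∃ λ t → NoCommonPrime n ∣ x + dot t v ∣
coprime-shift n x [] free = [] , λ p prime-p p∣n p∣x →
  free p (prime-p , p∣n) (subst (λ z → p ∣ ∣ z ∣) (ℤₚ.+-identityʳ x) p∣x , [])
coprime-shift n x (y ∷ v) free with coprime-shift n (x + T * y) v free′
  where
  T = + avoidingProduct n x
  free′ : ∀ p → PrimeDivisor n p → ¬ ((p ∣ ∣ x + T * y ∣) × DividesAll p v)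
  free′ p (prime-p , p∣n) (p∣x+Ty , p∣v) with p ∣? ∣ x ∣
  ... | no p∤x = p∤x (∣-+-cancelʳ x (T * y) p∣x+Ty (∣-*ˡ T y (∤⇒∣avoidingProduct {x = x} prime-p p∣n p∤x)))
  ... | yes p∣x with prime∣*⇒ prime-p T y (∣-+-cancelʳ (T * y) x (subst (λ z → p ∣ ∣ z ∣) (ℤₚ.+-comm x (T * y)) p∣x+Ty) p∣x)
  ...   | inj₁ p∣T = ∣avoidingProduct⇒∤ {x = x} prime-p p∣T p∣x
  ...   | inj₂ p∣y = free p (prime-p , p∣n) (p∣x , p∣y ∷ p∣v)
... | t , ncp = + avoidingProduct n x ∷ t ,
  subst (λ z → NoCommonPrime n ∣ z ∣) (ℤₚ.+-assoc x (+ avoidingProduct n x * y) (dot t v)) ncp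

-- A finite search, since the divisors of n are at most n. It decides constructively whether a row
-- is unimodular modulo n.
findPrimeDivisor : ∀ n .{{_ : NonZero n}} {k} (v : Vec ℤ k) →
                   Dec (∃ λ p → PrimeDivisor n p × DividesAll p v)
findPrimeDivisor n v = map′
  (λ any → let p , _ , found = find any in p , found)
  (λ (p , (prime-p , p∣n) , p∣v) → lose (∈-upTo⁺ (ℕ.s≤s (ℕ∣.∣⇒≤ p∣n))) ((prime-p , p∣n) , p∣v))
  (ListAny.any? (λ p → primeDivisor? n p ×-dec dividesAll? p v) (upTo (suc n)))

-- Determinant, trace and column operations for vectors of rows

Rows : ℕ → ℕ → Set
Rows j k = Vec (Vec ℤ k) j

_≈ᵛ_[mod_] : ∀ {k} → Vec ℤ k → Vec ℤ k → ℕ → Set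
v ≈ᵛ w [mod N ] = Pointwise (_≡_[mod N ]) v w

_≈ᴹ_[mod_] : ∀ {j k} → Rows j k → Rows j k → ℕ → Set
X ≈ᴹ Y [mod N ] = Pointwise (_≈ᵛ_[mod N ]) X Y

≈ᵛ-refl : ∀ {k N} {v : Vec ℤ k} → v ≈ᵛ v [mod N ]
≈ᵛ-refl = Pointwise.refl mod-refl

≈ᴹ-refl : ∀ {j k N} {X : Rows j k} → X ≈ᴹ X [mod N ]
≈ᴹ-refl = Pointwise.refl ≈ᵛ-refl

entries : ∀ {k} → Rows k k → SquareMatrix k
entries X i j = lookup (lookup X i) j

det : ∀ {k} → Rows k k → ℤ
det {k} X = detℤ k (entries X)

-- Defined by deleting the first row and column, as the induction on the size does; `tr-lift`
-- identifies it with the sum over the diagonal.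
tr : ∀ {k} → Rows k k → ℤ
tr []            = 0ℤ
tr ((x ∷ v) ∷ X) = x + tr (Vec.map Vec.tail X)

det-mod : ∀ {k N} (X Y : Rows k k) → X ≈ᴹ Y [mod N ] → det X ≡ det Y [mod N ]
det-mod {N = N} X Y X≡Y = det-preserves (_≡_[mod N ]) mod-refl mod-+ mod-* (entries X) (entries Y)
  λ i j → Pointwise.lookup (Pointwise.lookup X≡Y i) j

tails-mod : ∀ {j k N} {X Y : Rows j (suc k)} → X ≈ᴹ Y [mod N ] →
            Vec.map Vec.tail X ≈ᴹ Vec.map Vec.tail Y [mod N ]
tails-mod []                                   = []
tails-mod {X = (_ ∷ _) ∷ _} {(_ ∷ _) ∷ _} ((_ ∷ v≡w) ∷ X≡Y) = v≡w ∷ tails-mod X≡Y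

tr-mod : ∀ {k N} (X Y : Rows k k) → X ≈ᴹ Y [mod N ] → tr X ≡ tr Y [mod N ]
tr-mod [] [] []                = mod-refl
tr-mod ((_ ∷ _) ∷ X) ((_ ∷ _) ∷ Y) ((x≡y ∷ _) ∷ X≡Y) =
  mod-+ x≡y (tr-mod (Vec.map Vec.tail X) (Vec.map Vec.tail Y) (tails-mod X≡Y))

-- Column operations act on each row by itself, hence they are maps of rows, applied to a matrix by
-- `Vec.map`. This one leaves everything outside the first column unchanged.
addDotToHead : ∀ {k} → Vec ℤ k → Vec ℤ (suc k) → Vec ℤ (suc k)
addDotToHead t (c ∷ b) = (c + dot t b) ∷ b

addHeadToTail : ∀ {k} → Vec ℤ k → Vec ℤ (suc k) → Vec ℤ (suc k)
addHeadToTail w (c ∷ b) = c ∷ Vec.zipWith _+_ b (Vec.map (c *_) w)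

dot≡sum : ∀ {k} (t v : Vec ℤ k) → dot t v ≡ sumℤ (tabulate λ j → lookup t j * lookup v j)
dot≡sum []      []      = refl
dot≡sum (t ∷ ts) (v ∷ vs) = cong (λ z → t * v + z) (dot≡sum ts vs)

det-addDotToHead : ∀ {k} (t : Vec ℤ k) (Y : Rows (suc k) (suc k)) → det (Vec.map (addDotToHead t) Y) ≡ det Y
det-addDotToHead t Y = det-first-add (lookup t) (entries Y) (entries (Vec.map (addDotToHead t) Y))
  (λ i → trans (cong (λ ρ → lookup ρ zero) (lookup-map i (addDotToHead t) Y)) (head (lookup Y i)))
  (λ i j → trans (cong (λ ρ → lookup ρ (suc j)) (lookup-map i (addDotToHead t) Y)) (tail (lookup Y i) j))
  where
  head : ∀ ρ → lookup (addDotToHead t ρ) zero ≡ lookup ρ zero + sumℤ (tabulate λ j → lookup t j * lookup ρ (suc j))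
  head (c ∷ b) = cong (λ z → c + z) (dot≡sum t b)
  tail : ∀ ρ j → lookup (addDotToHead t ρ) (suc j) ≡ lookup ρ (suc j)
  tail (c ∷ b) j = refl

det-addHeadToTail : ∀ {k} (w : Vec ℤ k) (Y : Rows (suc k) (suc k)) → det (Vec.map (addHeadToTail w) Y) ≡ det Y
det-addHeadToTail w Y = det-add-first (lookup w) (entries Y) (entries (Vec.map (addHeadToTail w) Y))
  (λ i → trans (cong (λ ρ → lookup ρ zero) (lookup-map i (addHeadToTail w) Y)) (head (lookup Y i)))
  (λ i j → trans (cong (λ ρ → lookup ρ (suc j)) (lookup-map i (addHeadToTail w) Y)) (tail (lookup Y i) j))
  where
  head : ∀ ρ → lookup (addHeadToTail w ρ) zero ≡ lookup ρ zero
  head (c ∷ b) = refl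
  tail : ∀ ρ j → lookup (addHeadToTail w ρ) (suc j) ≡ lookup ρ (suc j) + lookup ρ zero * lookup w j
  tail (c ∷ b) j = trans (lookup-zipWith _+_ j b (Vec.map (c *_) w))
                         (cong (λ z → lookup b j + z) (lookup-map j (c *_) w))

det-row-zero : ∀ {k} x (X : Rows k (suc k)) →
               det ((x ∷ Vec.replicate k 0ℤ) ∷ X) ≡ x * det (Vec.map Vec.tail X)
det-row-zero {k} x X = trans (det-expand M)
  (trans (cong₂ _+_ leading (sum-zero (λ j → cofactorTerm M (suc j)) others)) (ℤₚ.+-identityʳ _))
  where
  M = entries ((x ∷ Vec.replicate k 0ℤ) ∷ X)
  lookup-tail : ∀ (ρ : Vec ℤ (suc k)) j → lookup ρ (suc j) ≡ lookup (Vec.tail ρ) j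
  lookup-tail (_ ∷ _) j = refl
  leading : cofactorTerm M zero ≡ x * det (Vec.map Vec.tail X)
  leading = trans (ℤₚ.*-identityˡ (x * detℤ k (minor zero M)))
    (cong (λ z → x * z) (det-cong (minor zero M) (entries (Vec.map Vec.tail X))
      λ i j → trans (lookup-tail (lookup X i) j) (cong (λ ρ → lookup ρ j) (sym (lookup-map i Vec.tail X)))))
  vanish : ∀ s d → s * (0ℤ * d) ≡ 0ℤ
  vanish = solve-∀
  others : ∀ j → cofactorTerm M (suc j) ≡ 0ℤ
  others j rewrite lookup-replicate j 0ℤ = vanish (sgn (toℕ (suc j))) (detℤ k (minor (suc j) M))

det-row-mod0 : ∀ {k N} {ρ : Vec ℤ (suc k)} (X : Rows k (suc k)) → DividesAll N ρ → det (ρ ∷ X) ≡ 0ℤ [mod N ]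
det-row-mod0 {k} {N} {x ∷ v} X (N∣x ∷ N∣v) =
  mod-trans (det-mod ((x ∷ v) ∷ X) ((0ℤ ∷ Vec.replicate k 0ℤ) ∷ X) ((∣⇒mod0 x N∣x ∷ dividesAll⇒mod0 N∣v) ∷ ≈ᴹ-refl))
    (mod-reflexive (trans (det-row-zero 0ℤ X) (ℤₚ.*-zeroˡ (det (Vec.map Vec.tail X)))))

-- Sieving

^-distribʳ-* : ∀ k a b → (a ℕ.* b) ℕ.^ k ≡ a ℕ.^ k ℕ.* b ℕ.^ k
^-distribʳ-* zero    a b = refl
^-distribʳ-* (suc k) a b = trans (cong (a ℕ.* b ℕ.*_) (^-distribʳ-* k a b))
                                 (*-interchange a b (a ℕ.^ k) (b ℕ.^ k))

-- Denominator and numerator of the product of 1 - p^-r over the primes p in P.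
powers predPowers : ℕ → List ℕ → ℕ
powers r P     = prodℕ (map (λ p → p ℕ.^ r) P)
predPowers r P = prodℕ (map (λ p → p ℕ.^ r ℕ.∸ 1) P)

module Sieve {c ℓ : Level} (R : CommutativeRing c ℓ) (m d : ℕ) .{{_ : NonZero m}} .{{_ : NonZero d}} where
  open CommutativeRing R using (Carrier; _≈_; 0#; 1#)
    renaming (_+_ to _⊕_; _*_ to _⊛_)
  private module R = CommutativeRing R
  open Summation R
  open import Algebra.Properties.Ring R.ring using (+-cancelʳ)
  open import Algebra.Solver.Ring.NaturalCoefficients.Default R.commutativeSemiring
    using (solve; _:=_; _:+_; _:*_; con)
  open import Relation.Binary.Reasoning.Setoid R.setoid

  n : ℕ
  n = d ℕ.* m

  SievingPrime : ℕ → Set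
  SievingPrime p = Prime p × (p ∣ d) × ¬ (p ∣ m)

  δ* : ∀ {k} → ℕ → Vec ℤ k → Carrier
  δ* N v = 𝟙 (dividesAll? N v)

  𝟙-× : {P Q S : Set} (p? : Dec P) (q? : Dec Q) (s? : Dec S) →
        (S → P) → (S → Q) → (P → Q → S) → 𝟙 p? ⊛ 𝟙 q? ≈ 𝟙 s?
  𝟙-× (yes p) (yes q) s? S⇒P S⇒Q PQ⇒S = R.trans (R.*-identityˡ 1#) (R.sym (𝟙-true s? (PQ⇒S p q)))
  𝟙-× (yes p) (no ¬q) s? S⇒P S⇒Q PQ⇒S = R.trans (R.zeroʳ 1#) (R.sym (𝟙-false s? λ s → ¬q (S⇒Q s)))
  𝟙-× (no ¬p) q? s? S⇒P S⇒Q PQ⇒S = R.trans (R.zeroˡ _) (R.sym (𝟙-false s? λ s → ¬p (S⇒P s)))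

  𝟙-¬ : {P : Set} (p? : Dec P) → 𝟙 p? ⊕ 𝟙 (¬? p?) ≈ 1#
  𝟙-¬ (yes p) = R.+-identityʳ 1#
  𝟙-¬ (no ¬p) = R.+-identityˡ 1#

  δ*-∷ : ∀ {k} N x (v : Vec ℤ k) → δ N x ⊛ δ* N v ≈ δ* N (x ∷ v)
  δ*-∷ N x v = 𝟙-× (N ∣? ∣ x ∣) (dividesAll? N v) (dividesAll? N (x ∷ v)) All.head All.tail _∷_

  δ*-* : ∀ {k a b} .{{_ : NonZero a}} → NoCommonPrime a b → (v : Vec ℤ k) → δ* b v ⊛ δ* a v ≈ δ* (b ℕ.* a) v
  δ*-* {a = a} {b} ncp v = 𝟙-× (dividesAll? b v) (dividesAll? a v) (dividesAll? (b ℕ.* a) v)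
    (All.map (ℕ∣.∣-trans (ℕ∣.m∣m*n a)))
    (All.map (ℕ∣.∣-trans (ℕ∣.n∣m*n b)))
    (λ b∣v a∣v → All.map (λ (b∣x , a∣x) → *-∣-noCommonPrime ncp a∣x b∣x) (All.zip (b∣v , a∣v)))

  avoid : ∀ {k} → List ℕ → Vec ℤ k → Carrier
  avoid []      ρ = 1#
  avoid (p ∷ P) ρ = 𝟙 (¬? (dividesAll? p ρ)) ⊛ avoid P ρ

  avoid-false : ∀ {k p P} (ρ : Vec ℤ k) → p ∈ P → DividesAll p ρ → avoid P ρ ≈ 0#
  avoid-false {p = p} ρ (here refl) p∣ρ =
    R.trans (R.*-congʳ (𝟙-false (¬? (dividesAll? p ρ)) (λ p∤ρ → p∤ρ p∣ρ))) (R.zeroˡ _)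
  avoid-false ρ (there p∈P) p∣ρ = R.trans (R.*-congˡ (avoid-false ρ p∈P p∣ρ)) (R.zeroʳ _)

  avoid-true : ∀ {k P} (ρ : Vec ℤ k) → ListAll.All (λ p → ¬ DividesAll p ρ) P → avoid P ρ ≈ 1#
  avoid-true ρ [] = R.refl
  avoid-true ρ (_∷_ {x = p} p∤ρ P∤ρ) =
    R.trans (R.*-cong (𝟙-true (¬? (dividesAll? p ρ)) p∤ρ) (avoid-true ρ P∤ρ)) (R.*-identityˡ 1#)

  count-multiples : ∀ q N .{{_ : NonZero N}} → n ≡ q ℕ.* N → ∀ k →
                    ∑ (allVecsOf (residues n) k) (δ* N) ≈ ι (q ℕ.^ k)
  count-multiples q N n≡ zero    = R.refl
  count-multiples q N n≡ (suc k) = begin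
    ∑ (allVecsOf (residues n) (suc k)) (δ* N)
      ≈⟨ ∑-allVecs (residues n) k (δ* N) ⟩
    ∑ (residues n) (λ x → ∑ (allVecsOf (residues n) k) (λ v → δ* N (x ∷ v)))
      ≈⟨ ∑-cong (residues n) (λ x → ∑-cong (allVecsOf (residues n) k) λ v → R.sym (δ*-∷ N x v)) ⟩
    ∑ (residues n) (λ x → ∑ (allVecsOf (residues n) k) (λ v → δ N x ⊛ δ* N v))
      ≈⟨ ∑-cong (residues n) (λ x → R.sym (∑-*ˡ (allVecsOf (residues n) k) (δ N x) (δ* N))) ⟩
    ∑ (residues n) (λ x → δ N x ⊛ ∑ (allVecsOf (residues n) k) (δ* N))
      ≈⟨ R.sym (∑-*ʳ (residues n) _ (δ N)) ⟩
    ∑ (residues n) (δ N) ⊛ ∑ (allVecsOf (residues n) k) (δ* N)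
      ≈⟨ R.*-cong single (count-multiples q N n≡ k) ⟩
    ι q ⊛ ι (q ℕ.^ k) ≈⟨ R.sym (ι-* q (q ℕ.^ k)) ⟩
    ι (q ℕ.* q ℕ.^ k) ∎
    where
    single : ∑ (residues n) (δ N) ≈ ι q
    single = begin
      ∑ (residues n) (δ N)
        ≡⟨ cong (λ l → ∑ (residues l) (δ N)) n≡ ⟩
      ∑ (residues (q ℕ.* N)) (δ N)
        ≈⟨ ∑-cong (residues (q ℕ.* N)) (λ x → δ-cong N (mod-reflexive (sym (ℤₚ.+-identityʳ x)))) ⟩
      ∑ (residues (q ℕ.* N)) (λ x → δ N (x + 0ℤ))   ≈⟨ ∑-δ-* q N 0ℤ ⟩
      ι q ∎

  module _ (g : ℤ → Carrier) (g-periodic : Periodic m g) where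

    G : Carrier
    G = ∑ (residues m) g

    -- In x = y + s m the condition Q ∣ x says s ≡ - m⁻¹ y (mod Q).
    sum-head : ∀ q Q .{{_ : NonZero Q}} → d ≡ q ℕ.* Q → NoCommonPrime Q m →
               ∑ (residues n) (λ x → g x ⊛ δ Q x) ≈ ι q ⊛ G
    sum-head q Q refl ncp with m′ , m′m≡1 ← noCommonPrime⇒invertible Q (+ m) ncp = begin
      ∑ (residues n) (λ x → g x ⊛ δ Q x)
        ≈⟨ ∑-residues-* d m _ ⟩
      ∑ (residues m) (λ y → ∑ (residues d) (λ s → g (y + s * + m) ⊛ δ Q (y + s * + m)))
        ≈⟨ ∑-cong (residues m) (λ y → ∑-cong (residues d) λ s →
             R.*-cong (g-periodic (witness s refl)) (solution y s)) ⟩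
      ∑ (residues m) (λ y → ∑ (residues d) (λ s → g y ⊛ δ Q (s + m′ * y)))
        ≈⟨ ∑-cong (residues m) (λ y → R.sym (∑-*ˡ (residues d) (g y) _)) ⟩
      ∑ (residues m) (λ y → g y ⊛ ∑ (residues d) (λ s → δ Q (s + m′ * y)))
        ≈⟨ ∑-cong (residues m) (λ y → R.trans (R.*-congˡ (∑-δ-* q Q (m′ * y))) (R.*-comm (g y) (ι q))) ⟩
      ∑ (residues m) (λ y → ι q ⊛ g y)
        ≈⟨ R.sym (∑-*ˡ (residues m) (ι q) g) ⟩
      ι q ⊛ G ∎
      where
      factorˡ : ∀ m′ m s y → m′ * (y + s * m) ≡ m′ * m * s + m′ * y
      factorˡ = solve-∀
      factorʳ : ∀ m′ m s y → m * (s + m′ * y) ≡ m′ * m * y + s * m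
      factorʳ = solve-∀
      to : ∀ y s → m′ * (y + s * + m) ≡ s + m′ * y [mod Q ]
      to y s = mod-trans (mod-reflexive (factorˡ m′ (+ m) s y))
        (mod-+ (mod-trans (mod-* m′m≡1 (mod-refl {x = s})) (mod-reflexive (ℤₚ.*-identityˡ s))) (mod-refl {x = m′ * y}))
      from : ∀ y s → + m * (s + m′ * y) ≡ y + s * + m [mod Q ]
      from y s = mod-trans (mod-reflexive (factorʳ m′ (+ m) s y))
        (mod-+ (mod-trans (mod-* m′m≡1 (mod-refl {x = y})) (mod-reflexive (ℤₚ.*-identityˡ y))) (mod-refl {x = s * + m}))
      multiple : ∀ z {x y} → z * x ≡ y [mod Q ] → Q ∣ ∣ x ∣ → Q ∣ ∣ y ∣
      multiple z {x} zx≡y Q∣x = ∣-resp-mod (mod-sym zx≡y)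
        (subst (λ w → Q ∣ ∣ w ∣) (ℤₚ.*-comm x z) (∣-*ˡ x z Q∣x))
      solution : ∀ y s → δ Q (y + s * + m) ≈ δ Q (s + m′ * y)
      solution y s = 𝟙-cong (Q ∣? ∣ y + s * + m ∣) (Q ∣? ∣ s + m′ * y ∣)
        (multiple m′ (to y s)) (multiple (+ m) (from y s))

    module _ (k : ℕ) where

      rows : List (Vec ℤ (suc k))
      rows = allVecsOf (residues n) (suc k)

      -- g will be x ↦ χ(x) K_k(e x), the value expected from a first row with corner x; the second
      -- factor keeps the rows with m ∣ v, the only ones to contribute.
      weight : Vec ℤ (suc k) → Carrier
      weight (x ∷ v) = g x ⊛ δ* m v

      -- As Q is prime to m, the conditions m ∣ v and Q ∣ v amount to m Q ∣ v. Since n = q (m Q),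
      -- this leaves q^k vectors v, and the first entry contributes q G by `sum-head`.
      sum-multiples : ∀ q Q .{{_ : NonZero Q}} → d ≡ q ℕ.* Q → NoCommonPrime Q m →
                      ∑ rows (λ ρ → weight ρ ⊛ δ* Q ρ) ≈ ι (q ℕ.^ suc k) ⊛ G
      sum-multiples q Q d≡qQ ncp = begin
        ∑ rows (λ ρ → weight ρ ⊛ δ* Q ρ)
          ≈⟨ ∑-allVecs (residues n) k _ ⟩
        ∑ (residues n) (λ x → ∑ (allVecsOf (residues n) k) (λ v → g x ⊛ δ* m v ⊛ δ* Q (x ∷ v)))
          ≈⟨ ∑-cong (residues n) (λ x → ∑-cong (allVecsOf (residues n) k) λ v → merge x v) ⟩
        ∑ (residues n) (λ x → ∑ (allVecsOf (residues n) k) (λ v → g x ⊛ δ Q x ⊛ δ* (m ℕ.* Q) v))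
          ≈⟨ ∑-cong (residues n) (λ x → R.sym (∑-*ˡ (allVecsOf (residues n) k) _ _)) ⟩
        ∑ (residues n) (λ x → g x ⊛ δ Q x ⊛ ∑ (allVecsOf (residues n) k) (δ* (m ℕ.* Q)))
          ≈⟨ R.sym (∑-*ʳ (residues n) _ _) ⟩
        ∑ (residues n) (λ x → g x ⊛ δ Q x) ⊛ ∑ (allVecsOf (residues n) k) (δ* (m ℕ.* Q))
          ≈⟨ R.*-cong (sum-head q Q d≡qQ ncp) (count-multiples q (m ℕ.* Q) {{ℕₚ.m*n≢0 m Q}} n≡ k) ⟩
        ι q ⊛ G ⊛ ι (q ℕ.^ k)
          ≈⟨ solve 3 (λ a b c → a :* b :* c := a :* c :* b) R.refl (ι q) G (ι (q ℕ.^ k)) ⟩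
        ι q ⊛ ι (q ℕ.^ k) ⊛ G
          ≈⟨ R.*-congʳ (R.sym (ι-* q (q ℕ.^ k))) ⟩
        ι (q ℕ.^ suc k) ⊛ G ∎
        where
        n≡ : n ≡ q ℕ.* (m ℕ.* Q)
        n≡ = trans (cong (ℕ._* m) d≡qQ) (trans (ℕₚ.*-assoc q Q m) (cong (q ℕ.*_) (ℕₚ.*-comm Q m)))
        merge : ∀ x (v : Vec ℤ k) → g x ⊛ δ* m v ⊛ δ* Q (x ∷ v) ≈ g x ⊛ δ Q x ⊛ δ* (m ℕ.* Q) v
        merge x v = begin
          g x ⊛ δ* m v ⊛ δ* Q (x ∷ v)          ≈⟨ R.*-congˡ (R.sym (δ*-∷ Q x v)) ⟩
          g x ⊛ δ* m v ⊛ (δ Q x ⊛ δ* Q v)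
            ≈⟨ solve 4 (λ a b c d → a :* b :* (c :* d) := a :* c :* (b :* d)) R.refl (g x) (δ* m v) (δ Q x) (δ* Q v) ⟩
          g x ⊛ δ Q x ⊛ (δ* m v ⊛ δ* Q v)      ≈⟨ R.*-congˡ (δ*-* ncp v) ⟩
          g x ⊛ δ Q x ⊛ δ* (m ℕ.* Q) v ∎

      -- Q is what has already been required to divide the row, P the list of primes still to be
      -- avoided.
      sifted : ℕ → List ℕ → Carrier
      sifted Q P = ∑ rows (λ ρ → weight ρ ⊛ (δ* Q ρ ⊛ avoid P ρ))

      sifted-split : ∀ Q p P .{{_ : NonZero Q}} → NoCommonPrime Q p →
                     sifted Q P ≈ sifted Q (p ∷ P) ⊕ sifted (p ℕ.* Q) P
      sifted-split Q p P ncp = R.trans (∑-cong rows λ ρ → begin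
        weight ρ ⊛ (δ* Q ρ ⊛ avoid P ρ)
          ≈⟨ R.*-congˡ (R.sym (R.*-identityˡ _)) ⟩
        weight ρ ⊛ (1# ⊛ (δ* Q ρ ⊛ avoid P ρ))
          ≈⟨ R.*-congˡ (R.*-congʳ (R.sym (𝟙-¬ (dividesAll? p ρ)))) ⟩
        weight ρ ⊛ ((δ* p ρ ⊕ 𝟙 (¬? (dividesAll? p ρ))) ⊛ (δ* Q ρ ⊛ avoid P ρ))
          ≈⟨ solve 5 (λ w a b q s → w :* ((a :+ b) :* (q :* s)) := w :* (q :* (b :* s)) :+ w :* (a :* q :* s))
               R.refl (weight ρ) (δ* p ρ) (𝟙 (¬? (dividesAll? p ρ))) (δ* Q ρ) (avoid P ρ) ⟩
        weight ρ ⊛ (δ* Q ρ ⊛ avoid (p ∷ P) ρ) ⊕ weight ρ ⊛ (δ* p ρ ⊛ δ* Q ρ ⊛ avoid P ρ)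
          ≈⟨ R.+-congˡ (R.*-congˡ (R.*-congʳ (δ*-* ncp ρ))) ⟩
        weight ρ ⊛ (δ* Q ρ ⊛ avoid (p ∷ P) ρ) ⊕ weight ρ ⊛ (δ* (p ℕ.* Q) ρ ⊛ avoid P ρ) ∎)
        (∑-⊕ rows _ _)

      -- Avoiding p is complementary to being divisible by p, and requiring divisibility by p
      -- replaces Q by p Q; hence the statement for general Q. The rows divisible by p account for
      -- the share p^-(k+1), so each p costs a factor 1 - p^-(k+1), written here with denominators
      -- cleared.
      sieve : ∀ Q P .{{_ : NonZero Q}} → Q ∣ d → NoCommonPrime Q m →
              ListAll.All SievingPrime P → Unique P → ListAll.All (λ p → ¬ p ∣ Q) P →
              ι (Q ℕ.^ suc k) ⊛ (ι (powers (suc k) P) ⊛ sifted Q P) ≈ ι (predPowers (suc k) P) ⊛ (ι (d ℕ.^ suc k) ⊛ G)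
      sieve Q [] (ℕ∣.divides q d≡qQ) ncp [] [] [] = begin
        ι (Q ℕ.^ suc k) ⊛ (ι 1 ⊛ sifted Q [])
          ≈⟨ R.*-congˡ (R.*-congˡ (∑-cong rows λ ρ → R.*-congˡ (R.*-identityʳ (δ* Q ρ)))) ⟩
        ι (Q ℕ.^ suc k) ⊛ (ι 1 ⊛ ∑ rows (λ ρ → weight ρ ⊛ δ* Q ρ))
          ≈⟨ R.*-congˡ (R.*-congˡ (sum-multiples q Q d≡qQ ncp)) ⟩
        ι (Q ℕ.^ suc k) ⊛ (ι 1 ⊛ (ι (q ℕ.^ suc k) ⊛ G))
          ≈⟨ solve 4 (λ a o b g → a :* (o :* (b :* g)) := o :* ((b :* a) :* g)) R.refl
               (ι (Q ℕ.^ suc k)) (ι 1) (ι (q ℕ.^ suc k)) G ⟩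
        ι 1 ⊛ (ι (q ℕ.^ suc k) ⊛ ι (Q ℕ.^ suc k) ⊛ G)
          ≈⟨ R.*-congˡ (R.*-congʳ (R.trans (R.sym (ι-* (q ℕ.^ suc k) (Q ℕ.^ suc k))) (R.reflexive (cong ι power)))) ⟩
        ι 1 ⊛ (ι (d ℕ.^ suc k) ⊛ G) ∎
        where
        power : q ℕ.^ suc k ℕ.* Q ℕ.^ suc k ≡ d ℕ.^ suc k
        power = trans (sym (^-distribʳ-* (suc k) q Q)) (cong (ℕ._^ suc k) (sym d≡qQ))
      sieve Q (p ∷ P) Q∣d ncp ((prime-p , p∣d , p∤m) ∷ primes) (p∉P ∷ unique) (p∤Q ∷ P∤Q) =
        -- With π for `ι (powers (suc k) P)`, Z is the value of both instances of the induction: of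
        -- a π (s + s′) at Q and of b a π s′ at p Q. The difference of b times the first and the
        -- second is (b - 1) Z = e Z.
        +-cancelʳ Z _ _ (begin
          a ⊛ (ι (p ℕ.^ suc k ℕ.* powers (suc k) P) ⊛ s) ⊕ Z
            ≈⟨ R.+-cong (R.*-congˡ (R.*-congʳ (ι-* (p ℕ.^ suc k) (powers (suc k) P)))) (R.sym divisible) ⟩
          a ⊛ (b ⊛ ι (powers (suc k) P) ⊛ s) ⊕ b ⊛ a ⊛ (ι (powers (suc k) P) ⊛ s′)
            ≈⟨ solve 5 (λ a b c x y → a :* (b :* c :* x) :+ b :* a :* (c :* y) := b :* (a :* (c :* (x :+ y))))
                 R.refl a b (ι (powers (suc k) P)) s s′ ⟩
          b ⊛ (a ⊛ (ι (powers (suc k) P) ⊛ (s ⊕ s′)))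
            ≈⟨ R.*-congˡ (R.*-congˡ (R.*-congˡ (R.sym (sifted-split Q p P Q⊥p)))) ⟩
          b ⊛ (a ⊛ (ι (powers (suc k) P) ⊛ sifted Q P))
            ≈⟨ R.*-cong b≈ (sieve Q P Q∣d ncp primes unique P∤Q) ⟩
          (e ⊕ 1#) ⊛ Z
            ≈⟨ R.trans (R.distribʳ Z e 1#) (R.+-congˡ (R.*-identityˡ Z)) ⟩
          e ⊛ Z ⊕ Z
            ≈⟨ R.+-congʳ (R.trans (R.sym (R.*-assoc e _ _)) (R.*-congʳ (R.sym (ι-* (p ℕ.^ suc k ℕ.∸ 1) (predPowers (suc k) P))))) ⟩
          ι ((p ℕ.^ suc k ℕ.∸ 1) ℕ.* predPowers (suc k) P) ⊛ (ι (d ℕ.^ suc k) ⊛ G) ⊕ Z ∎)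
        where
        instance
          p≢0 : NonZero p
          p≢0 = prime⇒nonZero prime-p
          pQ≢0 : NonZero (p ℕ.* Q)
          pQ≢0 = ℕₚ.m*n≢0 p Q
        a = ι (Q ℕ.^ suc k)
        b = ι (p ℕ.^ suc k)
        e = ι (p ℕ.^ suc k ℕ.∸ 1)
        s = sifted Q (p ∷ P)
        s′ = sifted (p ℕ.* Q) P
        Z = ι (predPowers (suc k) P) ⊛ (ι (d ℕ.^ suc k) ⊛ G)
        Q⊥p : NoCommonPrime Q p
        Q⊥p q prime-q q∣Q q∣p = p∤Q (subst (_∣ Q) (prime∣prime prime-q prime-p q∣p) q∣Q)
        b≈ : b ≈ e ⊕ 1#
        b≈ = R.trans (R.reflexive (cong ι (sym (ℕₚ.suc-pred (p ℕ.^ suc k) {{ℕₚ.m^n≢0 p (suc k)}})))) (R.+-comm 1# e)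
        P∤pQ : ListAll.All (λ q → ¬ q ∣ p ℕ.* Q) P
        P∤pQ = ListAll.zipWith (λ { ((prime-q , _) , p≢q , q∤Q) q∣pQ →
          [ (λ q∣p → p≢q (sym (prime∣prime prime-q prime-p q∣p))) , q∤Q ]′ (euclidsLemma p Q prime-q q∣pQ) })
          (primes , ListAll.zip (p∉P , P∤Q))
        divisible : b ⊛ a ⊛ (ι (powers (suc k) P) ⊛ s′) ≈ Z
        divisible = R.trans
          (R.*-congʳ (R.trans (R.sym (ι-* (p ℕ.^ suc k) (Q ℕ.^ suc k)))
                              (R.reflexive (cong ι (sym (^-distribʳ-* (suc k) p Q))))))
          (sieve (p ℕ.* Q) P (*-∣-noCommonPrime Q⊥p Q∣d p∣d)
            (noCommonPrime-* (prime∤⇒noCommonPrime prime-p p∤m) ncp) primes unique P∤pQ)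

-- The recursion

sumVec prodVec : ∀ {k} → Vec ℤ k → ℤ
sumVec  = Vec.foldr _ _+_ 0ℤ
prodVec = Vec.foldr _ _*_ 1ℤ

sub1-≢ : ∀ {p N} → Prime p → p ∣ N → ∀ z → p ∣ ∣ z ∣ → ¬ N ∣ ∣ z - 1ℤ ∣
sub1-≢ {p} prime-p p∣N z p∣z N∣z-1 = prime∤1 prime-p
  (mod0⇒∣ (mod-trans (mod-sym (mod-∣ p∣N (∣⇒mod z 1ℤ N∣z-1))) (∣⇒mod0 z p∣z)))

-- The index is the size minus one, the induction starting from 1 × 1 matrices. The factors are
-- listed as `T-step` produces them; `denominator≡` and `numerator≡` give the closed forms.
denominator : List ℕ → ℕ → ℕ
denominator P zero    = 1
denominator P (suc j) = denominator P j ℕ.* powers (suc (suc j)) P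

-- From size k = j + 1 to k + 1, the factor n^k counts the entries below the corner, which become
-- free once the row is cleared; the powers of d and p come from the sieve.
numerator : ℕ → ℕ → List ℕ → ℕ → ℕ
numerator n d P zero    = 1
numerator n d P (suc j) =
  numerator n d P j ℕ.* (n ℕ.^ suc j ℕ.* (d ℕ.^ suc (suc j) ℕ.* predPowers (suc (suc j)) P))

-- χ abstracts from λ: it turns sums into products, has period m = n / d and takes the value 1 at
-- multiples of m only.
module GaussSum {c ℓ : Level} (R : CommutativeRing c ℓ) (m d : ℕ) .{{_ : NonZero m}} .{{_ : NonZero d}}
  (χ : ℤ → CommutativeRing.Carrier R)
  (χ-+ : ∀ x y → CommutativeRing._≈_ R (χ (x + y)) (CommutativeRing._*_ R (χ x) (χ y)))
  (χ-mod : ∀ {x y} → x ≡ y [mod m ] → CommutativeRing._≈_ R (χ x) (χ y))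
  (χ-faithful : ∀ z → CommutativeRing._≈_ R (χ z) (CommutativeRing.1# R) → m ∣ ∣ z ∣)
  (no-zero-divisors : ∀ x y → CommutativeRing._≈_ R (CommutativeRing._*_ R x y) (CommutativeRing.0# R) →
    CommutativeRing._≈_ R x (CommutativeRing.0# R) ⊎ CommutativeRing._≈_ R y (CommutativeRing.0# R))
  where
  open CommutativeRing R using (Carrier; _≈_; 0#; 1#)
    renaming (_+_ to _⊕_; _*_ to _⊛_; -_ to ⊖_)
  private module R = CommutativeRing R
  open Summation R
  open Sieve R m d using (n; δ*; avoid; avoid-true; avoid-false; SievingPrime; sieve; sifted; weight)
  open import Algebra.Properties.Ring R.ring using (x+x≈x⇒x≈0; -‿distribˡ-*; +-cancelʳ)
  open import Algebra.Solver.Ring.NaturalCoefficients.Default R.commutativeSemiring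
    using (solve; _:=_; _:+_; _:*_; con)
  open import Relation.Binary.Reasoning.Setoid R.setoid

  instance
    n≢0 : NonZero n
    n≢0 = ℕₚ.m*n≢0 d m

  m∣n : m ∣ n
  m∣n = ℕ∣.n∣m*n d

  sieving : List ℕ
  sieving = primesDivNotDiv n m

  sieving? : ∀ p → Dec (Prime p × (p ∣ n) × ¬ (p ∣ m))
  sieving? p = prime? p ×-dec (p ∣? n) ×-dec ¬? (p ∣? m)

  sieving-all : ListAll.All (λ p → Prime p × (p ∣ n) × ¬ (p ∣ m)) sieving
  sieving-all = ListAllₚ.all-filter sieving? (upTo (suc n))

  matrices : ∀ j k → List (Rows j k)
  matrices j k = allVecsOf (allVecsOf (residues n) k) j

  T : ℕ → ℤ → Carrier
  T k e = ∑ (matrices k k) (λ X → δ n (e * det X - 1ℤ) ⊛ χ (tr X))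

  K : ℕ → ℤ → Carrier
  K k e = ∑ (allVecsOf (residues m) k) (λ x → δ m (e * prodVec x - 1ℤ) ⊛ χ (sumVec x))

  δ-term-mod : ∀ N e {x y} → x ≡ y [mod N ] → δ N (e * x - 1ℤ) ≈ δ N (e * y - 1ℤ)
  δ-term-mod N e x≡y = δ-cong N (mod-+ (mod-* (mod-refl {x = e}) x≡y) (mod-refl {x = - 1ℤ}))

  K-mod : ∀ k {e e′} → e ≡ e′ [mod m ] → K k e ≈ K k e′
  K-mod k e≡e′ = ∑-cong (allVecsOf (residues m) k) λ x → R.*-congʳ
    (δ-cong m (mod-+ (mod-* e≡e′ (mod-refl {x = prodVec x})) (mod-refl {x = - 1ℤ})))

  K-suc : ∀ k e → K (suc k) e ≈ ∑ (residues m) (λ y → χ y ⊛ K k (e * y))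
  K-suc k e = begin
    K (suc k) e
      ≈⟨ ∑-allVecs (residues m) k _ ⟩
    ∑ (residues m) (λ y → ∑ (allVecsOf (residues m) k) (λ x → δ m (e * (y * prodVec x) - 1ℤ) ⊛ χ (y + sumVec x)))
      ≈⟨ ∑-cong (residues m) (λ y → ∑-cong (allVecsOf (residues m) k) (term y)) ⟩
    ∑ (residues m) (λ y → ∑ (allVecsOf (residues m) k) (λ x → χ y ⊛ (δ m (e * y * prodVec x - 1ℤ) ⊛ χ (sumVec x))))
      ≈⟨ ∑-cong (residues m) (λ y → R.sym (∑-*ˡ (allVecsOf (residues m) k) (χ y) _)) ⟩
    ∑ (residues m) (λ y → χ y ⊛ K k (e * y)) ∎
    where
    term : ∀ y (x : Vec ℤ k) → δ m (e * (y * prodVec x) - 1ℤ) ⊛ χ (y + sumVec x)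
                             ≈ χ y ⊛ (δ m (e * y * prodVec x - 1ℤ) ⊛ χ (sumVec x))
    term y x = begin
      δ m (e * (y * prodVec x) - 1ℤ) ⊛ χ (y + sumVec x)
        ≈⟨ R.*-cong (R.reflexive (cong (λ z → δ m (z - 1ℤ)) (sym (ℤₚ.*-assoc e y (prodVec x))))) (χ-+ y (sumVec x)) ⟩
      δ m (e * y * prodVec x - 1ℤ) ⊛ (χ y ⊛ χ (sumVec x))
        ≈⟨ solve 3 (λ a b c → a :* (b :* c) := b :* (a :* c)) R.refl _ (χ y) (χ (sumVec x)) ⟩
      χ y ⊛ (δ m (e * y * prodVec x - 1ℤ) ⊛ χ (sumVec x)) ∎

  K-noninvertible : ∀ {p} k e → Prime p → p ∣ m → p ∣ ∣ e ∣ → K k e ≈ 0#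
  K-noninvertible k e prime-p p∣m p∣e = ∑-zero (allVecsOf (residues m) k) λ x → R.trans
    (R.*-congʳ (δ-false m (e * prodVec x - 1ℤ)
      (sub1-≢ prime-p p∣m (e * prodVec x) (∣-*ˡ e (prodVec x) p∣e))))
    (R.zeroˡ _)

  sum-solution : ∀ N .{{_ : NonZero N}} e y → y * e ≡ 1ℤ [mod N ] → ∀ f → Periodic N f →
                 ∑ (residues N) (λ x → δ N (e * x - 1ℤ) ⊛ f x) ≈ f y
  sum-solution N e y ye≡1 f per = R.trans
    (∑-cong (residues N) λ x → R.*-congʳ (𝟙-cong (N ∣? ∣ e * x - 1ℤ ∣) (N ∣? ∣ x - y ∣)
      (λ N∣ → mod⇒∣ (to x (∣⇒mod (e * x) 1ℤ N∣))) (λ N∣ → mod⇒∣ (from x (∣⇒mod x y N∣)))))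
    (∑-pick N y f per)
    where
    rearrange : ∀ x y e → y * e * x ≡ y * (e * x)
    rearrange = solve-∀
    to : ∀ x → e * x ≡ 1ℤ [mod N ] → x ≡ y [mod N ]
    to x ex≡1 = mod-trans (mod-reflexive (sym (ℤₚ.*-identityˡ x)))
      (mod-trans (mod-* (mod-sym ye≡1) (mod-refl {x = x}))
      (mod-trans (mod-reflexive (rearrange x y e))
      (mod-trans (mod-* (mod-refl {x = y}) ex≡1) (mod-reflexive (ℤₚ.*-identityʳ y)))))
    from : ∀ x → x ≡ y [mod N ] → e * x ≡ 1ℤ [mod N ]
    from x x≡y = mod-trans (mod-* (mod-refl {x = e}) x≡y) (mod-trans (mod-reflexive (ℤₚ.*-comm e y)) ye≡1)

  -- Both sides are χ(y): x ≡ y is the only solution of e x ≡ 1, modulo n as well as modulo m.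
  T-1 : ∀ e → Invertible n e → T 1 e ≈ K 1 e
  T-1 e (y , ye≡1) = R.trans
    (R.trans (∑-allVecs (allVecsOf (residues n) 1) 0 _)
      (R.trans (∑-cong (allVecsOf (residues n) 1) λ ρ → R.+-identityʳ _)
        (R.trans (∑-allVecs (residues n) 0 _)
          (∑-cong (residues n) λ x → R.trans (R.+-identityʳ _)
            (R.*-cong (R.reflexive (cong (λ z → δ n (e * z - 1ℤ)) (det-1 x))) (R.reflexive (cong χ (ℤₚ.+-identityʳ x))))))))
    (R.trans (sum-solution n e y ye≡1 χ (λ x≡y → χ-mod (mod-∣ m∣n x≡y)))
      (R.sym (R.trans
        (R.trans (∑-allVecs (residues m) 0 _)
          (∑-cong (residues m) λ x → R.trans (R.+-identityʳ _)
            (R.*-cong (R.reflexive (cong (λ z → δ m (e * z - 1ℤ)) (ℤₚ.*-identityʳ x))) (R.reflexive (cong χ (ℤₚ.+-identityʳ x))))))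
        (sum-solution m e y (mod-∣ m∣n ye≡1) χ χ-mod))))
    where
    det-1 : ∀ x → det ((x ∷ []) ∷ []) ≡ x
    det-1 x = trans (det-row-zero x []) (ℤₚ.*-identityʳ x)

  -- For a fixed tail b the head is translated by the constant `dot t b`, hence the exchange of the
  -- two sums.
  addDotToHead-invariant : ∀ {k} (t : Vec ℤ k) →
    Invariant (_≈ᵛ_[mod n ]) (allVecsOf (residues n) (suc k)) (addDotToHead t)
  addDotToHead-invariant {k} t f f-mod = begin
    ∑ (allVecsOf (residues n) (suc k)) (λ ρ → f (addDotToHead t ρ))
      ≈⟨ ∑-allVecs (residues n) k _ ⟩
    ∑ (residues n) (λ c → ∑ (allVecsOf (residues n) k) (λ b → f ((c + dot t b) ∷ b)))
      ≈⟨ ∑-swap (residues n) (allVecsOf (residues n) k) _ ⟩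
    ∑ (allVecsOf (residues n) k) (λ b → ∑ (residues n) (λ c → f ((c + dot t b) ∷ b)))
      ≈⟨ ∑-cong (allVecsOf (residues n) k) (λ b →
           ∑-translate n (dot t b) (λ c → f (c ∷ b)) λ x≡y → f-mod (x≡y ∷ ≈ᵛ-refl)) ⟩
    ∑ (allVecsOf (residues n) k) (λ b → ∑ (residues n) (λ c → f (c ∷ b)))
      ≈⟨ ∑-swap (allVecsOf (residues n) k) (residues n) _ ⟩
    ∑ (residues n) (λ c → ∑ (allVecsOf (residues n) k) (λ b → f (c ∷ b)))
      ≈⟨ R.sym (∑-allVecs (residues n) k f) ⟩
    ∑ (allVecsOf (residues n) (suc k)) f ∎

  translate-invariant : ∀ {k} (u : Vec ℤ k) →
    Invariant (_≈ᵛ_[mod n ]) (allVecsOf (residues n) k) (λ v → Vec.zipWith _+_ v u)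
  translate-invariant []      f f-mod = R.refl
  translate-invariant {suc k} (t ∷ u) f f-mod = begin
    ∑ (allVecsOf (residues n) (suc k)) (λ v → f (Vec.zipWith _+_ v (t ∷ u)))
      ≈⟨ ∑-allVecs (residues n) k _ ⟩
    ∑ (residues n) (λ x → ∑ (allVecsOf (residues n) k) (λ v → f ((x + t) ∷ Vec.zipWith _+_ v u)))
      ≈⟨ ∑-cong (residues n) (λ x → translate-invariant u (λ v → f ((x + t) ∷ v)) λ v≡w → f-mod (mod-refl ∷ v≡w)) ⟩
    ∑ (residues n) (λ x → ∑ (allVecsOf (residues n) k) (λ v → f ((x + t) ∷ v)))
      ≈⟨ ∑-translate n t (λ x → ∑ (allVecsOf (residues n) k) (λ v → f (x ∷ v)))
           (λ x≡y → ∑-cong (allVecsOf (residues n) k) λ v → f-mod (x≡y ∷ ≈ᵛ-refl)) ⟩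
    ∑ (residues n) (λ x → ∑ (allVecsOf (residues n) k) (λ v → f (x ∷ v)))
      ≈⟨ R.sym (∑-allVecs (residues n) k f) ⟩
    ∑ (allVecsOf (residues n) (suc k)) f ∎

  addHeadToTail-invariant : ∀ {k} (w : Vec ℤ k) →
    Invariant (_≈ᵛ_[mod n ]) (allVecsOf (residues n) (suc k)) (addHeadToTail w)
  addHeadToTail-invariant {k} w f f-mod = begin
    ∑ (allVecsOf (residues n) (suc k)) (λ ρ → f (addHeadToTail w ρ))
      ≈⟨ ∑-allVecs (residues n) k _ ⟩
    ∑ (residues n) (λ c → ∑ (allVecsOf (residues n) k) (λ b → f (c ∷ Vec.zipWith _+_ b (Vec.map (c *_) w))))
      ≈⟨ ∑-cong (residues n) (λ c →
           translate-invariant (Vec.map (c *_) w) (λ b → f (c ∷ b)) λ v≡w → f-mod (mod-refl ∷ v≡w)) ⟩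
    ∑ (residues n) (λ c → ∑ (allVecsOf (residues n) k) (λ b → f (c ∷ b)))
      ≈⟨ R.sym (∑-allVecs (residues n) k f) ⟩
    ∑ (allVecsOf (residues n) (suc k)) f ∎

  tails-fibre : ∀ k (f : Vec ℤ k → Carrier) →
    ∑ (allVecsOf (residues n) (suc k)) (λ ρ → f (Vec.tail ρ)) ≈ ι n ⊛ ∑ (allVecsOf (residues n) k) f
  tails-fibre k f = R.trans (∑-allVecs (residues n) k _) (ι-∑ n _)

  tails-addDotToHead : ∀ {j k} (t : Vec ℤ k) (X : Rows j (suc k)) →
                       Vec.map Vec.tail (Vec.map (addDotToHead t) X) ≡ Vec.map Vec.tail X
  tails-addDotToHead t []            = refl
  tails-addDotToHead t ((c ∷ b) ∷ X) = cong (b ∷_) (tails-addDotToHead t X)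

  translate-mod : ∀ {k} c {w : Vec ℤ k} → DividesAll m w → ∀ b →
                  Vec.zipWith _+_ b (Vec.map (c *_) w) ≈ᵛ b [mod m ]
  translate-mod c []          []      = []
  translate-mod c {y ∷ w} (m∣y ∷ m∣w) (x ∷ b) = mod-trans
    (mod-+ (mod-refl {x = x}) (mod-trans (mod-* (mod-refl {x = c}) (∣⇒mod0 y m∣y)) (mod-reflexive (ℤₚ.*-zeroʳ c))))
    (mod-reflexive (ℤₚ.+-identityʳ x)) ∷ translate-mod c m∣w b

  tails-addHeadToTail : ∀ {j k} {w : Vec ℤ k} → DividesAll m w → (X : Rows j (suc k)) →
    Vec.map Vec.tail (Vec.map (addHeadToTail w) X) ≈ᴹ Vec.map Vec.tail X [mod m ]
  tails-addHeadToTail m∣w []            = []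
  tails-addHeadToTail m∣w ((c ∷ b) ∷ X) = translate-mod c m∣w b ∷ tails-addHeadToTail m∣w X

  -- Splitting off the first row

  module Step (k : ℕ) (e : ℤ) where

    lowerRows : List (Rows k (suc k))
    lowerRows = matrices k (suc k)

    -- x stands for the first entry of ρ: only its class modulo m matters in the trace, while ρ is changed by column operations.
    term : Vec ℤ (suc k) → ℤ → Rows k (suc k) → Carrier
    term ρ x X = δ n (e * det (ρ ∷ X) - 1ℤ) ⊛ χ (x + tr (Vec.map Vec.tail X))

    inner : ℤ → Vec ℤ k → Carrier
    inner x v = ∑ lowerRows (term (x ∷ v) x)

    T-suc : T (suc k) e ≈ ∑ (allVecsOf (residues n) k) (λ v → ∑ (residues n) (λ x → inner x v))
    T-suc = R.trans (∑-allVecs (allVecsOf (residues n) (suc k)) k _)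
      (R.trans (∑-allVecs (residues n) k _) (∑-swap (residues n) (allVecsOf (residues n) k) _))

    term-mod : ∀ ρ ρ′ x x′ X X′ → ρ ≈ᵛ ρ′ [mod n ] → x ≡ x′ [mod m ] → X ≈ᴹ X′ [mod n ] →
               term ρ x X ≈ term ρ′ x′ X′
    term-mod ρ ρ′ x x′ X X′ ρ≡ x≡ X≡ = R.*-cong
      (δ-term-mod n e (det-mod (ρ ∷ X) (ρ′ ∷ X′) (ρ≡ ∷ X≡)))
      (χ-mod (mod-+ x≡ (mod-∣ m∣n (tr-mod (Vec.map Vec.tail X) (Vec.map Vec.tail X′) (tails-mod X≡)))))

    term-addDotToHead : ∀ t ρ x X → term (addDotToHead t ρ) x (Vec.map (addDotToHead t) X) ≈ term ρ x X
    term-addDotToHead t ρ x X = R.*-cong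
      (R.reflexive (cong (λ z → δ n (e * z - 1ℤ)) (det-addDotToHead t (ρ ∷ X))))
      (R.reflexive (cong (λ Y → χ (x + tr Y)) (tails-addDotToHead t X)))

    term-addHeadToTail : ∀ {w} → DividesAll m w → ∀ ρ x X →
                         term (addHeadToTail w ρ) x (Vec.map (addHeadToTail w) X) ≈ term ρ x X
    term-addHeadToTail {w} m∣w ρ x X = R.*-cong
      (R.reflexive (cong (λ z → δ n (e * z - 1ℤ)) (det-addHeadToTail w (ρ ∷ X))))
      (χ-mod (mod-+ (mod-refl {x = x}) (tr-mod (Vec.map Vec.tail (Vec.map (addHeadToTail w) X)) (Vec.map Vec.tail X) (tails-addHeadToTail m∣w X))))

    term-trace : ∀ ρ y x X → term ρ (y + x) X ≈ χ y ⊛ term ρ x X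
    term-trace ρ y x X = begin
      Δ ⊛ χ (y + x + τ)         ≈⟨ R.*-congˡ (R.trans (R.reflexive (cong χ (ℤₚ.+-assoc y x τ))) (χ-+ y (x + τ))) ⟩
      Δ ⊛ (χ y ⊛ χ (x + τ))     ≈⟨ solve 3 (λ a b c → a :* (b :* c) := b :* (a :* c)) R.refl Δ (χ y) (χ (x + τ)) ⟩
      χ y ⊛ (Δ ⊛ χ (x + τ)) ∎
      where
      τ = tr (Vec.map Vec.tail X)
      Δ = δ n (e * det (ρ ∷ X) - 1ℤ)

    reindex-addDotToHead : ∀ t ρ x → ∑ lowerRows (λ X → term ρ x (Vec.map (addDotToHead t) X)) ≈ ∑ lowerRows (term ρ x)
    reindex-addDotToHead t ρ x = Invariant-map ≈ᵛ-refl (addDotToHead-invariant t) k (term ρ x)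
      (λ {X} {Y} → term-mod ρ ρ x x X Y ≈ᵛ-refl (mod-refl {x = x}))

    reindex-addHeadToTail : ∀ w ρ x → ∑ lowerRows (λ X → term ρ x (Vec.map (addHeadToTail w) X)) ≈ ∑ lowerRows (term ρ x)
    reindex-addHeadToTail w ρ x = Invariant-map ≈ᵛ-refl (addHeadToTail-invariant w) k (term ρ x)
      (λ {X} {Y} → term-mod ρ ρ x x X Y ≈ᵛ-refl (mod-refl {x = x}))

    -- Adding t-multiples of the other columns to the first one multiplies the sum by χ (dot t v).
    vanishing : ∀ v → ¬ DividesAll m v → ∑ (residues n) (λ x → inner x v) ≈ 0#
    vanishing v m∤v with t , m∤tv ← dot-detects m v m∤v = conclude
      (no-zero-divisors (χ (dot t v) ⊕ ⊖ 1#) S (begin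
        (χ (dot t v) ⊕ ⊖ 1#) ⊛ S              ≈⟨ R.distribʳ S (χ (dot t v)) (⊖ 1#) ⟩
        χ (dot t v) ⊛ S ⊕ ⊖ 1# ⊛ S            ≈⟨ R.+-cong (R.sym scaled) (R.trans (R.sym (-‿distribˡ-* 1# S)) (R.-‿cong (R.*-identityˡ S))) ⟩
        S ⊕ ⊖ S                               ≈⟨ R.-‿inverseʳ S ⟩
        0# ∎))
      where
      S = ∑ (residues n) (λ x → inner x v)
      -- `(x + dot t v) ∷ v` is `addDotToHead t (x ∷ v)`, so the whole matrix has undergone the
      -- column operation: its determinant is the old one, and only the corner entry of the trace
      -- moves.
      pointwise : ∀ x X → term ((x + dot t v) ∷ v) (x + dot t v) (Vec.map (addDotToHead t) X)
                          ≈ χ (dot t v) ⊛ term (x ∷ v) x X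
      pointwise x X = R.trans (term-addDotToHead t (x ∷ v) (x + dot t v) X)
        (R.trans (R.reflexive (cong (λ z → term (x ∷ v) z X) (ℤₚ.+-comm x (dot t v))))
          (term-trace (x ∷ v) (dot t v) x X))
      scaled : S ≈ χ (dot t v) ⊛ S
      scaled = begin
        ∑ (residues n) (λ x → inner x v)
          ≈⟨ R.sym (∑-translate n (dot t v) (λ x → inner x v) λ {x} {y} x≡y → ∑-cong lowerRows λ X →
               term-mod (x ∷ v) (y ∷ v) x y X X (x≡y ∷ ≈ᵛ-refl) (mod-∣ m∣n x≡y) ≈ᴹ-refl) ⟩
        ∑ (residues n) (λ x → inner (x + dot t v) v)
          ≈⟨ ∑-cong (residues n) (λ x → R.sym (reindex-addDotToHead t ((x + dot t v) ∷ v) (x + dot t v))) ⟩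
        ∑ (residues n) (λ x → ∑ lowerRows (λ X → term ((x + dot t v) ∷ v) (x + dot t v) (Vec.map (addDotToHead t) X)))
          ≈⟨ ∑-cong (residues n) (λ x → R.trans (∑-cong lowerRows (pointwise x)) (R.sym (∑-*ˡ lowerRows (χ (dot t v)) _))) ⟩
        ∑ (residues n) (λ x → χ (dot t v) ⊛ inner x v)
          ≈⟨ R.sym (∑-*ˡ (residues n) (χ (dot t v)) _) ⟩
        χ (dot t v) ⊛ S ∎
      conclude : χ (dot t v) ⊕ ⊖ 1# ≈ 0# ⊎ S ≈ 0# → S ≈ 0#
      conclude (inj₂ S≈0)   = S≈0
      conclude (inj₁ χ-1≈0) = contradiction (χ-faithful (dot t v)
        (+-cancelʳ (⊖ 1#) _ _ (R.trans χ-1≈0 (R.sym (R.-‿inverseʳ 1#))))) m∤tv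

    -- p divides the determinant of every such matrix, so e det ≡ 1 fails already modulo p.
    inner-noninvertible : ∀ {p} x v → PrimeDivisor n p → DividesAll p (x ∷ v) → inner x v ≈ 0#
    inner-noninvertible x v (prime-p , p∣n) p∣ρ = ∑-zero lowerRows λ X → R.trans
      (R.*-congʳ (δ-false n (e * det ((x ∷ v) ∷ X) - 1ℤ)
        (sub1-≢ prime-p p∣n (e * det ((x ∷ v) ∷ X))
          (subst (λ z → _ ∣ ∣ z ∣) (ℤₚ.*-comm (det ((x ∷ v) ∷ X)) e)
            (∣-*ˡ (det ((x ∷ v) ∷ X)) e (mod0⇒∣ (det-row-mod0 X p∣ρ)))))))
      (R.zeroˡ _)

    -- Column operations turn the first row into (x′, 0, …, 0), with x′ ≡ x (mod m) invertible modulo n.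
    inner-invertible : Invertible n e → ∀ x v → DividesAll m v →
      (∀ p → PrimeDivisor n p → ¬ DividesAll p (x ∷ v)) →
      ∃ λ x′ → x′ ≡ x [mod m ] × Invertible n (e * x′) × inner x v ≈ ι (n ℕ.^ k) ⊛ (χ x ⊛ T k (e * x′))
    inner-invertible inv-e x v m∣v free
      with t , ncp ← coprime-shift n x v (λ p pd (p∣x , p∣v) → free p pd (p∣x ∷ p∣v))
      with y , yx′≡1 ← noCommonPrime⇒invertible n (x + dot t v) ncp
      = x′ , mod-trans (mod-+ (mod-refl {x = x}) (dot-dividesAll t m∣v)) (mod-reflexive (ℤₚ.+-identityʳ x))
      , invertible-* inv-e (y , yx′≡1)
      , (begin
        ∑ lowerRows (term (x ∷ v) x)
          ≈⟨ ∑-cong lowerRows (λ X → R.sym (term-addDotToHead t (x ∷ v) x X)) ⟩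
        ∑ lowerRows (λ X → term (x′ ∷ v) x (Vec.map (addDotToHead t) X))
          ≈⟨ reindex-addDotToHead t (x′ ∷ v) x ⟩
        ∑ lowerRows (term (x′ ∷ v) x)
          ≈⟨ ∑-cong lowerRows (λ X → R.sym (term-addHeadToTail (m∣w v m∣v) (x′ ∷ v) x X)) ⟩
        ∑ lowerRows (λ X → term (addHeadToTail (w v) (x′ ∷ v)) x (Vec.map (addHeadToTail (w v)) X))
          ≈⟨ reindex-addHeadToTail (w v) (addHeadToTail (w v) (x′ ∷ v)) x ⟩
        ∑ lowerRows (term (addHeadToTail (w v) (x′ ∷ v)) x)
          ≈⟨ ∑-cong lowerRows triangular ⟩
        ∑ lowerRows (λ X → χ x ⊛ (δ n (e * x′ * det (Vec.map Vec.tail X) - 1ℤ) ⊛ χ (tr (Vec.map Vec.tail X))))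
          ≈⟨ R.sym (∑-*ˡ lowerRows (χ x) _) ⟩
        χ x ⊛ ∑ lowerRows (λ X → δ n (e * x′ * det (Vec.map Vec.tail X) - 1ℤ) ⊛ χ (tr (Vec.map Vec.tail X)))
          -- The summand no longer involves the first entries of the k lower rows; forgetting them
          -- is n^k to one.
          ≈⟨ R.*-congˡ (∑-allVecs-fibres (allVecsOf (residues n) k) (allVecsOf (residues n) (suc k)) Vec.tail n
               (tails-fibre k) k (λ B → δ n (e * x′ * det B - 1ℤ) ⊛ χ (tr B))) ⟩
        χ x ⊛ (ι (n ℕ.^ k) ⊛ T k (e * x′))
          ≈⟨ solve 3 (λ a b c → a :* (b :* c) := b :* (a :* c)) R.refl (χ x) (ι (n ℕ.^ k)) (T k (e * x′)) ⟩
        ι (n ℕ.^ k) ⊛ (χ x ⊛ T k (e * x′)) ∎)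
      where
      x′ = x + dot t v
      -- With y inverse to x′ modulo n, adding -y z times the first column sends an entry z of the
      -- first row to z - x′ y z ≡ 0. As m ∣ z, each multiplier is divisible by m, which keeps the
      -- trace modulo m.
      w : ∀ {l} → Vec ℤ l → Vec ℤ l
      w = Vec.map (λ z → z * - y)
      m∣w : ∀ {l} (v : Vec ℤ l) → DividesAll m v → DividesAll m (w v)
      m∣w []      []          = []
      m∣w (z ∷ v) (m∣z ∷ m∣v) = ∣-*ˡ z (- y) m∣z ∷ m∣w v m∣v
      cleared : ∀ {l} (v : Vec ℤ l) → Vec.zipWith _+_ v (Vec.map (x′ *_) (w v)) ≈ᵛ Vec.replicate l 0ℤ [mod n ]
      cleared []      = []
      cleared (z ∷ v) = mod-trans (mod-reflexive (regroup z x′ y))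
        (mod-trans (mod-+ (mod-refl {x = z}) (mod-* (mod-refl {x = - z}) yx′≡1)) (mod-reflexive (cancel z))) ∷ cleared v
        where
        regroup : ∀ z x y → z + x * (z * - y) ≡ z + - z * (y * x)
        regroup = solve-∀
        cancel : ∀ z → z + - z * 1ℤ ≡ 0ℤ
        cancel = solve-∀
      triangular : ∀ X → term (addHeadToTail (w v) (x′ ∷ v)) x X
                   ≈ χ x ⊛ (δ n (e * x′ * det (Vec.map Vec.tail X) - 1ℤ) ⊛ χ (tr (Vec.map Vec.tail X)))
      triangular X = begin
        term (addHeadToTail (w v) (x′ ∷ v)) x X
          ≈⟨ term-mod (addHeadToTail (w v) (x′ ∷ v)) (x′ ∷ Vec.replicate k 0ℤ) x x X X (mod-refl ∷ cleared v) (mod-refl {x = x}) ≈ᴹ-refl ⟩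
        δ n (e * det ((x′ ∷ Vec.replicate k 0ℤ) ∷ X) - 1ℤ) ⊛ χ (x + τ)
          ≈⟨ R.*-cong (R.reflexive (cong (λ z → δ n (z - 1ℤ))
               (trans (cong (e *_) (det-row-zero x′ X)) (sym (ℤₚ.*-assoc e x′ D))))) (χ-+ x τ) ⟩
        δ n (e * x′ * D - 1ℤ) ⊛ (χ x ⊛ χ τ)
          ≈⟨ solve 3 (λ a b c → a :* (b :* c) := b :* (a :* c)) R.refl _ (χ x) (χ τ) ⟩
        χ x ⊛ (δ n (e * x′ * D - 1ℤ) ⊛ χ τ) ∎
        where
        τ = tr (Vec.map Vec.tail X)
        D = det (Vec.map Vec.tail X)

    module _ (P Q : ℕ) (IH : ∀ e → Invertible n e → ι P ⊛ T k e ≈ ι Q ⊛ K k e) (inv-e : Invertible n e) where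

      private
        g : ℤ → Carrier
        g x = χ x ⊛ K k (e * x)

        g-periodic : Periodic m g
        g-periodic x≡y = R.*-cong (χ-mod x≡y) (K-mod k (mod-* (mod-refl {x = e}) x≡y))

        C : Carrier
        C = ι Q ⊛ ι (n ℕ.^ k)

      -- If a prime p ∣ n divides the row, the left side is 0, and on the right `avoid` vanishes
      -- when p does not divide m, K_k(e x) when it does. Otherwise the induction hypothesis is
      -- applied at e x′, and K_k sees x′ only modulo m, where it equals x.
      inner-value : ∀ x v → DividesAll m v → ι P ⊛ inner x v ≈ C ⊛ (g x ⊛ avoid sieving (x ∷ v))
      inner-value x v m∣v = byCases (findPrimeDivisor n (x ∷ v))
        where
        noninvertible : ∀ p → Prime p → p ∣ n → DividesAll p (x ∷ v) → Dec (p ∣ m) → g x ⊛ avoid sieving (x ∷ v) ≈ 0#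
        noninvertible p prime-p p∣n p∣ρ (no p∤m) = R.trans (R.*-congˡ (avoid-false {P = sieving} (x ∷ v)
          (∈-filter⁺ sieving? (∈-upTo⁺ (ℕ.s≤s (ℕ∣.∣⇒≤ p∣n))) (prime-p , p∣n , p∤m)) p∣ρ)) (R.zeroʳ (g x))
        noninvertible p prime-p p∣n p∣ρ (yes p∣m) = R.trans
          (R.*-congʳ (R.trans (R.*-congˡ (K-noninvertible k (e * x) prime-p p∣m
            (subst (λ z → p ∣ ∣ z ∣) (ℤₚ.*-comm x e) (∣-*ˡ x e (All.head p∣ρ))))) (R.zeroʳ (χ x))))
          (R.zeroˡ (avoid sieving (x ∷ v)))
        invertible : (∀ p → PrimeDivisor n p → ¬ DividesAll p (x ∷ v)) →
          ∃ (λ x′ → x′ ≡ x [mod m ] × Invertible n (e * x′) × inner x v ≈ ι (n ℕ.^ k) ⊛ (χ x ⊛ T k (e * x′))) →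
          ι P ⊛ inner x v ≈ C ⊛ (g x ⊛ avoid sieving (x ∷ v))
        invertible free (x′ , x′≡x , inv-ex′ , eq) = begin
          ι P ⊛ inner x v
            ≈⟨ R.*-congˡ eq ⟩
          ι P ⊛ (ι (n ℕ.^ k) ⊛ (χ x ⊛ T k (e * x′)))
            ≈⟨ solve 4 (λ a b c d → a :* (b :* (c :* d)) := b :* (c :* (a :* d))) R.refl (ι P) (ι (n ℕ.^ k)) (χ x) (T k (e * x′)) ⟩
          ι (n ℕ.^ k) ⊛ (χ x ⊛ (ι P ⊛ T k (e * x′)))
            ≈⟨ R.*-congˡ (R.*-congˡ (IH (e * x′) inv-ex′)) ⟩
          ι (n ℕ.^ k) ⊛ (χ x ⊛ (ι Q ⊛ K k (e * x′)))
            ≈⟨ R.*-congˡ (R.*-congˡ (R.*-congˡ (K-mod k (mod-* (mod-refl {x = e}) x′≡x)))) ⟩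
          ι (n ℕ.^ k) ⊛ (χ x ⊛ (ι Q ⊛ K k (e * x)))
            ≈⟨ solve 4 (λ a b c d → a :* (b :* (c :* d)) := c :* a :* (b :* d)) R.refl (ι (n ℕ.^ k)) (χ x) (ι Q) (K k (e * x)) ⟩
          C ⊛ g x
            ≈⟨ R.*-congˡ (R.sym (R.trans (R.*-congˡ (avoid-true {P = sieving} (x ∷ v) unmet)) (R.*-identityʳ (g x)))) ⟩
          C ⊛ (g x ⊛ avoid sieving (x ∷ v)) ∎
          where
          unmet : ListAll.All (λ p → ¬ DividesAll p (x ∷ v)) sieving
          unmet = ListAll.map (λ {p} (prime-p , p∣n , _) → free p (prime-p , p∣n)) sieving-all
        byCases : Dec (∃ λ p → PrimeDivisor n p × DividesAll p (x ∷ v)) →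
                  ι P ⊛ inner x v ≈ C ⊛ (g x ⊛ avoid sieving (x ∷ v))
        byCases (yes (p , (prime-p , p∣n) , p∣ρ)) = R.trans
          (R.trans (R.*-congˡ (inner-noninvertible x v (prime-p , p∣n) p∣ρ)) (R.zeroʳ (ι P)))
          (R.sym (R.trans (R.*-congˡ (noninvertible p prime-p p∣n p∣ρ (p ∣? m))) (R.zeroʳ C)))
        byCases (no none) = invertible free (inner-invertible inv-e x v m∣v free)
          where
          free : ∀ p → PrimeDivisor n p → ¬ DividesAll p (x ∷ v)
          free p pd p∣ρ = none (p , pd , p∣ρ)

      -- `δ* 1` is always 1; writing it out gives the sum the shape of `sifted` at Q = 1, where the
      -- sieve starts.
      summand : ℤ → Vec ℤ k → Carrier
      summand x v = g x ⊛ δ* m v ⊛ (δ* 1 (x ∷ v) ⊛ avoid sieving (x ∷ v))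

      -- Stated for the sum over x and not for each x, because `vanishing` concerns only that sum.
      column-value : ∀ v → ι P ⊛ ∑ (residues n) (λ x → inner x v) ≈ ∑ (residues n) (λ x → C ⊛ summand x v)
      column-value v = byCases (dividesAll? m v)
        where
        byCases : Dec (DividesAll m v) → ι P ⊛ ∑ (residues n) (λ x → inner x v) ≈ ∑ (residues n) (λ x → C ⊛ summand x v)
        byCases (no m∤v) = R.trans (R.trans (R.*-congˡ (vanishing v m∤v)) (R.zeroʳ (ι P)))
          (R.sym (∑-zero (residues n) λ x → R.trans
            (R.*-congˡ (R.trans (R.*-congʳ (R.trans (R.*-congˡ (𝟙-false (dividesAll? m v) m∤v)) (R.zeroʳ (g x))))
                                (R.zeroˡ (δ* 1 (x ∷ v) ⊛ avoid sieving (x ∷ v)))))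
            (R.zeroʳ C)))
        byCases (yes m∣v) = R.trans (∑-*ˡ (residues n) (ι P) (λ x → inner x v)) (∑-cong (residues n) λ x →
          R.trans (inner-value x v m∣v) (R.*-congˡ (R.*-cong
            (R.sym (R.trans (R.*-congˡ (𝟙-true (dividesAll? m v) m∣v)) (R.*-identityʳ (g x))))
            (R.sym (R.trans (R.*-congʳ (𝟙-true (dividesAll? 1 (x ∷ v)) (All.universal (λ z → ℕ∣.1∣ ∣ z ∣) (x ∷ v))))
                            (R.*-identityˡ (avoid sieving (x ∷ v))))))))

      T-sifted : ι P ⊛ T (suc k) e ≈ C ⊛ sifted g g-periodic k 1 sieving
      T-sifted = begin
        ι P ⊛ T (suc k) e
          ≈⟨ R.*-congˡ T-suc ⟩
        ι P ⊛ ∑ (allVecsOf (residues n) k) (λ v → ∑ (residues n) (λ x → inner x v))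
          ≈⟨ ∑-*ˡ (allVecsOf (residues n) k) (ι P) _ ⟩
        ∑ (allVecsOf (residues n) k) (λ v → ι P ⊛ ∑ (residues n) (λ x → inner x v))
          ≈⟨ ∑-cong (allVecsOf (residues n) k) column-value ⟩
        ∑ (allVecsOf (residues n) k) (λ v → ∑ (residues n) (λ x → C ⊛ summand x v))
          ≈⟨ ∑-cong (allVecsOf (residues n) k) (λ v → R.sym (∑-*ˡ (residues n) C _)) ⟩
        ∑ (allVecsOf (residues n) k) (λ v → C ⊛ ∑ (residues n) (λ x → summand x v))
          ≈⟨ R.sym (∑-*ˡ (allVecsOf (residues n) k) C _) ⟩
        C ⊛ ∑ (allVecsOf (residues n) k) (λ v → ∑ (residues n) (λ x → summand x v))
          ≈⟨ R.*-congˡ (R.trans (∑-swap (allVecsOf (residues n) k) (residues n) _) (R.sym (∑-allVecs (residues n) k (λ ρ → weight g g-periodic k ρ ⊛ (δ* 1 ρ ⊛ avoid sieving ρ))))) ⟩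
        C ⊛ sifted g g-periodic k 1 sieving ∎

      sieving-primes : ListAll.All SievingPrime sieving
      sieving-primes = ListAll.map sieves
        sieving-all
        where
        sieves : ∀ {p} → Prime p × (p ∣ n) × ¬ (p ∣ m) → SievingPrime p
        sieves (prime-p , p∣n , p∤m) =
          prime-p , [ (λ p∣d → p∣d) , (λ p∣m → contradiction p∣m p∤m) ]′ (euclidsLemma d m prime-p p∣n) , p∤m

      T-step : ι (P ℕ.* powers (suc k) sieving) ⊛ T (suc k) e
               ≈ ι (Q ℕ.* (n ℕ.^ k ℕ.* (d ℕ.^ suc k ℕ.* predPowers (suc k) sieving))) ⊛ K (suc k) e
      T-step = begin
        ι (P ℕ.* powers (suc k) sieving) ⊛ T (suc k) e
          ≈⟨ R.*-congʳ (ι-* P (powers (suc k) sieving)) ⟩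
        ι P ⊛ π ⊛ T (suc k) e
          ≈⟨ solve 3 (λ a b c → a :* b :* c := b :* (a :* c)) R.refl (ι P) π (T (suc k) e) ⟩
        π ⊛ (ι P ⊛ T (suc k) e)
          ≈⟨ R.*-congˡ T-sifted ⟩
        π ⊛ (C ⊛ s)
          ≈⟨ solve 3 (λ a b c → a :* (b :* c) := b :* (a :* c)) R.refl π C s ⟩
        C ⊛ (π ⊛ s)
          ≈⟨ R.*-congˡ (R.sym (R.trans (R.*-congʳ (R.trans (R.reflexive (cong ι (ℕₚ.^-zeroˡ (suc k)))) ι-1)) (R.*-identityˡ _))) ⟩
        C ⊛ (ι (1 ℕ.^ suc k) ⊛ (π ⊛ s))
          ≈⟨ R.*-congˡ (sieve g g-periodic k 1 sieving (ℕ∣.1∣ d) (λ p prime-p p∣1 _ → prime∤1 prime-p p∣1)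
               sieving-primes (Uniqueₚ.filter⁺ sieving? (Uniqueₚ.upTo⁺ (suc n)))
               (ListAll.map (λ (prime-p , _) → prime∤1 prime-p) sieving-primes)) ⟩
        C ⊛ (ι pred ⊛ (ι (d ℕ.^ suc k) ⊛ ∑ (residues m) g))
          ≈⟨ R.*-congˡ (R.*-congˡ (R.*-congˡ (R.sym (K-suc k e)))) ⟩
        C ⊛ (ι pred ⊛ (ι (d ℕ.^ suc k) ⊛ K (suc k) e))
          ≈⟨ solve 5 (λ q a b c x → q :* a :* (b :* (c :* x)) := q :* (a :* (c :* b)) :* x) R.refl
               (ι Q) (ι (n ℕ.^ k)) (ι pred) (ι (d ℕ.^ suc k)) (K (suc k) e) ⟩
        ι Q ⊛ (ι (n ℕ.^ k) ⊛ (ι (d ℕ.^ suc k) ⊛ ι pred)) ⊛ K (suc k) e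
          ≈⟨ R.*-congʳ (R.sym (R.trans (ι-* Q _) (R.*-congˡ (R.trans (ι-* (n ℕ.^ k) _) (R.*-congˡ (ι-* (d ℕ.^ suc k) pred)))))) ⟩
        ι (Q ℕ.* (n ℕ.^ k ℕ.* (d ℕ.^ suc k ℕ.* pred))) ⊛ K (suc k) e ∎
        where
        π = ι (powers (suc k) sieving)
        s = sifted g g-periodic k 1 sieving
        pred = predPowers (suc k) sieving

  T-evaluation : ∀ j e → Invertible n e → ι (denominator sieving j) ⊛ T (suc j) e ≈ ι (numerator n d sieving j) ⊛ K (suc j) e
  T-evaluation zero    e inv-e = R.*-congˡ (T-1 e inv-e)
  T-evaluation (suc j) e inv-e =
    Step.T-step (suc j) e (denominator sieving j) (numerator n d sieving j) (T-evaluation j) inv-e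

-- Comparison with the statement

prodℕ-map-* : {A : Set} (f g : A → ℕ) (xs : List A) →
              prodℕ (map (λ x → f x ℕ.* g x) xs) ≡ prodℕ (map f xs) ℕ.* prodℕ (map g xs)
prodℕ-map-* f g []       = refl
prodℕ-map-* f g (x ∷ xs) = trans (cong (f x ℕ.* g x ℕ.*_) (prodℕ-map-* f g xs))
  (*-interchange (f x) (g x) (prodℕ (map f xs)) (prodℕ (map g xs)))

prodℕ-∷ʳ : ∀ xs a → prodℕ (xs ∷ʳ a) ≡ prodℕ xs ℕ.* a
prodℕ-∷ʳ []       a = trans (ℕₚ.*-identityʳ a) (sym (ℕₚ.*-identityˡ a))
prodℕ-∷ʳ (x ∷ xs) a = trans (cong (x ℕ.*_) (prodℕ-∷ʳ xs a)) (sym (ℕₚ.*-assoc x (prodℕ xs) a))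

prodℕ-map-1 : {A : Set} (xs : List A) → prodℕ (map (λ _ → 1) xs) ≡ 1
prodℕ-map-1 []       = refl
prodℕ-map-1 (x ∷ xs) = trans (ℕₚ.*-identityˡ _) (prodℕ-map-1 xs)

-- The common shape of `denomP` and `numerP`, with F p i equal to p^i and to p^i - 1.
doubleProduct : (ℕ → ℕ → ℕ) → List ℕ → ℕ → ℕ
doubleProduct F P r = prodℕ (map (λ p → prodℕ (map (F p) (twoTo r))) P)

doubleProduct-suc : ∀ F P j → doubleProduct F P (suc (suc j))
                    ≡ doubleProduct F P (suc j) ℕ.* prodℕ (map (λ p → F p (suc (suc j))) P)
doubleProduct-suc F P j = trans (cong prodℕ (map-cong last P)) (prodℕ-map-* _ _ P)
  where
  last : ∀ p → prodℕ (map (F p) (twoTo (suc (suc j)))) ≡ prodℕ (map (F p) (twoTo (suc j))) ℕ.* F p (suc (suc j))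
  last p = trans (cong (λ l → prodℕ (map (F p) (map (2 ℕ.+_) l))) (sym (upTo-∷ʳ j)))
    (trans (cong (λ l → prodℕ (map (F p) l)) (map-++ (2 ℕ.+_) (upTo j) (j ∷ [])))
    (trans (cong prodℕ (map-++ (F p) (twoTo (suc j)) (suc (suc j) ∷ [])))
      (prodℕ-∷ʳ (map (F p) (twoTo (suc j))) (F p (suc (suc j))))))

denominator≡ : ∀ P j → denominator P j ≡ doubleProduct ℕ._^_ P (suc j)
denominator≡ P zero    = sym (prodℕ-map-1 P)
denominator≡ P (suc j) = trans (cong (ℕ._* powers (suc (suc j)) P) (denominator≡ P j))
                               (sym (doubleProduct-suc ℕ._^_ P j))

-- Both exponents are halves of products of consecutive numbers, which grow by an even amount at
-- each step; this takes the increment out of the integer division.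
half-step : ∀ a b → (a ℕ.+ b ℕ.* 2) ℕ./ 2 ≡ a ℕ./ 2 ℕ.+ b
half-step a b = trans (ℕ/.+-distrib-/-∣ʳ a (ℕ∣.n∣m*n b)) (cong (a ℕ./ 2 ℕ.+_) (ℕ/.m*n/n≡m b 2))

exponentₙ exponent-d : ℕ → ℕ
exponentₙ j  = (suc j ℕ.* j) ℕ./ 2
exponent-d j = (suc j ℕ.* suc (suc j)) ℕ./ 2 ℕ.∸ 1

exponentₙ-suc : ∀ j → exponentₙ (suc j) ≡ exponentₙ j ℕ.+ suc j
exponentₙ-suc j = trans (cong (ℕ._/ 2) (expand j)) (half-step (suc j ℕ.* j) (suc j))
  where
  expand : ∀ j → (2 ℕ.+ j) ℕ.* (1 ℕ.+ j) ≡ (1 ℕ.+ j) ℕ.* j ℕ.+ (1 ℕ.+ j) ℕ.* 2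
  expand = ℕ-Solver.solve-∀

exponent-d-suc : ∀ j → exponent-d (suc j) ≡ exponent-d j ℕ.+ suc (suc j)
exponent-d-suc j = trans
  (cong (ℕ._∸ 1) (trans (cong (ℕ._/ 2) (expand j)) (half-step (suc j ℕ.* suc (suc j)) (suc (suc j)))))
  -- `∸` is truncated, so moving the summand out of it requires (j+1)(j+2)/2 ≥ 1.
  (ℕₚ.+-∸-comm (suc (suc j)) (ℕ/.m≥n⇒m/n>0 {suc j ℕ.* suc (suc j)} {2}
    (ℕₚ.≤-trans (ℕ.s≤s (ℕ.s≤s ℕ.z≤n)) (ℕₚ.m≤n*m (suc (suc j)) (suc j)))))
  where
  expand : ∀ j → (2 ℕ.+ j) ℕ.* (3 ℕ.+ j) ≡ (1 ℕ.+ j) ℕ.* (2 ℕ.+ j) ℕ.+ (2 ℕ.+ j) ℕ.* 2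
  expand = ℕ-Solver.solve-∀

numerator≡ : ∀ n d P j → numerator n d P j
             ≡ n ℕ.^ exponentₙ j ℕ.* d ℕ.^ exponent-d j ℕ.* doubleProduct (λ p i → p ℕ.^ i ℕ.∸ 1) P (suc j)
numerator≡ n d P zero    = sym (trans (ℕₚ.*-identityˡ (prodℕ (map (λ _ → 1) P))) (prodℕ-map-1 P))
numerator≡ n d P (suc j) = begin
  numerator n d P j ℕ.* (n ℕ.^ suc j ℕ.* (d ℕ.^ suc (suc j) ℕ.* new))
    ≡⟨ cong (ℕ._* (n ℕ.^ suc j ℕ.* (d ℕ.^ suc (suc j) ℕ.* new))) (numerator≡ n d P j) ⟩
  n ℕ.^ exponentₙ j ℕ.* d ℕ.^ exponent-d j ℕ.* old ℕ.* (n ℕ.^ suc j ℕ.* (d ℕ.^ suc (suc j) ℕ.* new))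
    ≡⟨ regroup (n ℕ.^ exponentₙ j) (d ℕ.^ exponent-d j) old (n ℕ.^ suc j) (d ℕ.^ suc (suc j)) new ⟩
  (n ℕ.^ exponentₙ j ℕ.* n ℕ.^ suc j) ℕ.* (d ℕ.^ exponent-d j ℕ.* d ℕ.^ suc (suc j)) ℕ.* (old ℕ.* new)
    ≡⟨ cong₂ (λ x y → x ℕ.* y ℕ.* (old ℕ.* new))
         (trans (sym (ℕₚ.^-distribˡ-+-* n (exponentₙ j) (suc j))) (cong (n ℕ.^_) (sym (exponentₙ-suc j))))
         (trans (sym (ℕₚ.^-distribˡ-+-* d (exponent-d j) (suc (suc j)))) (cong (d ℕ.^_) (sym (exponent-d-suc j)))) ⟩
  n ℕ.^ exponentₙ (suc j) ℕ.* d ℕ.^ exponent-d (suc j) ℕ.* (old ℕ.* new)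
    ≡⟨ cong (n ℕ.^ exponentₙ (suc j) ℕ.* d ℕ.^ exponent-d (suc j) ℕ.*_) (sym (doubleProduct-suc (λ p i → p ℕ.^ i ℕ.∸ 1) P j)) ⟩
  n ℕ.^ exponentₙ (suc j) ℕ.* d ℕ.^ exponent-d (suc j) ℕ.* doubleProduct (λ p i → p ℕ.^ i ℕ.∸ 1) P (suc (suc j)) ∎
  where
  open ≡-Reasoning
  old = doubleProduct (λ p i → p ℕ.^ i ℕ.∸ 1) P (suc j)
  new = predPowers (suc (suc j)) P
  regroup : ∀ a b c x y z → a ℕ.* b ℕ.* c ℕ.* (x ℕ.* (y ℕ.* z)) ≡ (a ℕ.* x) ℕ.* (b ℕ.* y) ℕ.* (c ℕ.* z)
  regroup = ℕ-Solver.solve-∀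

-- From entries in `Fin` to integer entries

allVecsOf-map : {A B : Set} (h : A → B) (xs : List A) → ∀ k →
                allVecsOf (map h xs) k ≡ map (Vec.map h) (allVecsOf xs k)
allVecsOf-map h xs zero    = refl
allVecsOf-map h xs (suc k) = trans (concatMap-map (λ y → map (y ∷_) (allVecsOf (map h xs) k)) h xs)
  (trans (concatMap-cong step xs) (sym (map-concatMap (Vec.map h) (λ x → map (x ∷_) (allVecsOf xs k)) xs)))
  where
  step : ∀ x → map (h x ∷_) (allVecsOf (map h xs) k) ≡ map (Vec.map h) (map (x ∷_) (allVecsOf xs k))
  step x = trans (cong (map (h x ∷_)) (allVecsOf-map h xs k))
    (trans (sym (map-∘ (allVecsOf xs k))) (map-∘ (allVecsOf xs k)))

lift : ∀ {n} → Fin n → ℤ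
lift i = + toℕ i

liftRows : ∀ {n j k} → Vec (Vec (Fin n) k) j → Rows j k
liftRows = Vec.map (Vec.map lift)

det-lift : ∀ {n r} (X : Mat n r) → det (liftRows X) ≡ detLift X
det-lift X = det-cong _ (λ i j → lift (lookup (lookup X i) j)) λ i j →
  trans (cong (λ v → lookup v j) (lookup-map i (Vec.map lift) X)) (lookup-map j lift (lookup X i))

tr-lift : ∀ {n r} (X : Mat n r) → tr (liftRows X) ≡ + trLift X
tr-lift {n} {r} X = trans (go X) (cong (λ l → + sumℕ l) (sym (map-tabulate id (λ i → toℕ (lookup (lookup X i) i)))))
  where
  tails-lift : ∀ {j k} (X : Vec (Vec (Fin n) (suc k)) j) → Vec.map Vec.tail (liftRows X) ≡ liftRows (Vec.map Vec.tail X)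
  tails-lift []            = refl
  tails-lift ((x ∷ v) ∷ X) = cong (Vec.map lift v ∷_) (tails-lift X)
  lookup-tail : ∀ {k} (v : Vec (Fin n) (suc k)) i → lookup (Vec.tail v) i ≡ lookup v (suc i)
  lookup-tail (_ ∷ _) i = refl
  tabulate-≡ : ∀ {k} {f g : Fin k → ℕ} → (∀ i → f i ≡ g i) → sumℕ (tabulate f) ≡ sumℕ (tabulate g)
  tabulate-≡ {zero}  f≡g = refl
  tabulate-≡ {suc k} f≡g = cong₂ ℕ._+_ (f≡g zero) (tabulate-≡ (λ i → f≡g (suc i)))
  go : ∀ {k} (X : Mat n k) → tr (liftRows X) ≡ + sumℕ (tabulate (λ i → toℕ (lookup (lookup X i) i)))
  go []            = refl
  go ((x ∷ v) ∷ X) = trans (cong (λ Y → lift x + tr Y) (tails-lift X))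
    (trans (cong (λ z → lift x + z) (go (Vec.map Vec.tail X)))
      (cong (λ s → + (toℕ x ℕ.+ s)) (tabulate-≡ λ i → cong toℕ
        (trans (cong (λ v → lookup v i) (lookup-map i Vec.tail X)) (lookup-tail (lookup X i) i)))))

prodVec≡ : ∀ {n k} (x : Vec (Fin n) k) → prodVec (Vec.map lift x) ≡ prodℤ (Vec.toList (Vec.map (λ y → + toℕ y) x))
prodVec≡ []      = refl
prodVec≡ (y ∷ x) = cong (λ z → lift y * z) (prodVec≡ x)

sumVec≡ : ∀ {n k} (x : Vec (Fin n) k) → sumVec (Vec.map lift x) ≡ + sumℕ (Vec.toList (Vec.map toℕ x))
sumVec≡ []      = refl
sumVec≡ (y ∷ x) = cong (λ z → lift y + z) (sumVec≡ x)

-- The character of ℤ given by the powers of ζ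

module Character {c ℓ : Level} (R : CommutativeRing c ℓ) (ζ : CommutativeRing.Carrier R) (n : ℕ) .{{_ : NonZero n}}
  (ζ-prim : PrimRootChar0 R n ζ) where
  open CommutativeRing R using (Carrier; _≈_; 0#; 1#)
    renaming (_+_ to _⊕_; _*_ to _⊛_)
  private module R = CommutativeRing R
  open PrimRootChar0 ζ-prim

  pow : ℕ → Carrier
  pow = powR R ζ

  pow-+ : ∀ a b → pow (a ℕ.+ b) ≈ pow a ⊛ pow b
  pow-+ zero    b = R.sym (R.*-identityˡ (pow b))
  pow-+ (suc a) b = R.trans (R.*-congˡ (pow-+ a b)) (R.sym (R.*-assoc ζ (pow a) (pow b)))

  pow-multiple : ∀ a q → pow (a ℕ.+ q ℕ.* n) ≈ pow a
  pow-multiple a q = R.trans (pow-+ a (q ℕ.* n)) (R.trans (R.*-congˡ (multiple q)) (R.*-identityʳ (pow a)))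
    where
    multiple : ∀ q → pow (q ℕ.* n) ≈ 1#
    multiple zero    = R.refl
    multiple (suc q) = R.trans (pow-+ n (q ℕ.* n)) (R.trans (R.*-cong root (multiple q)) (R.*-identityˡ 1#))

  pow-mod : ∀ a b → + a ≡ + b [mod n ] → pow a ≈ pow b
  pow-mod a b (witness (+ q) eq) = R.trans
    (R.reflexive (cong pow (ℤₚ.+-injective (trans eq (cong (λ z → + b + z) (sym (ℤₚ.pos-* q n))))))) (pow-multiple b q)
  -- A negative quotient exchanges the roles of a and b: here b = a + (q + 1) n.
  pow-mod a b (witness -[1+ q ] eq) = R.sym (R.trans
    (R.reflexive (cong pow (ℤₚ.+-injective (trans (move (+ b) (+ suc q) (+ n))
      (trans (cong (λ z → z + + suc q * + n) (sym eq)) (cong (λ z → + a + z) (sym (ℤₚ.pos-* (suc q) n)))))))) (pow-multiple a (suc q)))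
    where
    move : ∀ b q n → b ≡ b + - q * n + q * n
    move = solve-∀

  -- Reducing the exponent first gives a meaning to negative arguments without an inverse of ζ.
  exp : ℤ → Carrier
  exp z = pow (z %ℕ n)

  exp-mod : ∀ {x y} → x ≡ y [mod n ] → exp x ≈ exp y
  exp-mod {x} {y} x≡y = pow-mod (x %ℕ n) (y %ℕ n)
    (mod-trans (mod-sym (mod-residue n x)) (mod-trans x≡y (mod-residue n y)))

  exp-ℕ : ∀ a z → + a ≡ z [mod n ] → pow a ≈ exp z
  exp-ℕ a z a≡z = pow-mod a (z %ℕ n) (mod-trans a≡z (mod-residue n z))

  exp-+ : ∀ x y → exp (x + y) ≈ exp x ⊛ exp y
  exp-+ x y = R.trans (R.sym (exp-ℕ (x %ℕ n ℕ.+ y %ℕ n) (x + y)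
      (mod-+ (mod-sym (mod-residue n x)) (mod-sym (mod-residue n y)))))
    (pow-+ (x %ℕ n) (y %ℕ n))

  exp-faithful : ∀ z → exp z ≈ 1# → n ∣ ∣ z ∣
  exp-faithful z exp≈1 = byResidue (z %ℕ n) refl
    where
    byResidue : ∀ k → z %ℕ n ≡ k → n ∣ ∣ z ∣
    byResidue zero    eq = mod0⇒∣ (subst (λ k → z ≡ + k [mod n ]) eq (mod-residue n z))
    byResidue (suc k) eq = contradiction exp≈1
      (isPrimitive (z %ℕ n) (subst (0 ℕ.<_) (sym eq) ℕ.z<s) (n%ℕd<d z n))

-- The character of the statement, and the theorem

module _ {c ℓ : Level} (R : CommutativeRing c ℓ) (ζ : CommutativeRing.Carrier R) (a : ℤ) (m d : ℕ)
  .{{_ : NonZero m}} .{{_ : NonZero d}} .{{_ : NonZero (d ℕ.* m)}}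
  (gcd≡d : gcd ∣ a ∣ (d ℕ.* m) ≡ d) (ζ-prim : PrimRootChar0 R (d ℕ.* m) ζ) where
  open CommutativeRing R using (Carrier; _≈_; 0#; 1#)
    renaming (_+_ to _⊕_; _*_ to _⊛_)
  private module R = CommutativeRing R
  open Summation R
  open Character R ζ (d ℕ.* m) ζ-prim

  private
    n : ℕ
    n = d ℕ.* m

    χ : ℤ → Carrier
    χ z = exp (a * z)

    d∣a : d ∣ ∣ a ∣
    d∣a = subst (_∣ ∣ a ∣) gcd≡d (gcd[m,n]∣m ∣ a ∣ n)

    χ-+ : ∀ x y → χ (x + y) ≈ χ x ⊛ χ y
    χ-+ x y = R.trans (R.reflexive (cong exp (ℤₚ.*-distribˡ-+ a x y))) (exp-+ (a * x) (a * y))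

    -- As d ∣ a, multiplication by a takes multiples of m to multiples of d m = n.
    χ-mod : ∀ {x y} → x ≡ y [mod m ] → χ x ≈ χ y
    χ-mod {y = y} (witness q refl) with witness s a≡sd ← ∣⇒mod0 a d∣a = exp-mod {y = a * y} (witness (s * q)
      (trans (ℤₚ.*-distribˡ-+ a y (q * + m)) (cong (λ z → a * y + z)
        (trans (cong (λ z → z * (q * + m)) (trans a≡sd (ℤₚ.+-identityˡ (s * + d))))
          (trans (regroup s (+ d) q (+ m)) (cong (λ z → s * q * z) (sym (ℤₚ.pos-* d m))))))))
      where
      regroup : ∀ s d q m → s * d * (q * m) ≡ s * q * (d * m)
      regroup = solve-∀

    -- ζ being primitive, n ∣ a z; with n ∣ n z this gives n ∣ gcd (z a, z n) = d z up to sign, and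
    -- cancelling d from n = d m leaves m ∣ z.
    χ-faithful : ∀ z → χ z ≈ 1# → m ∣ ∣ z ∣
    χ-faithful z χz≈1 = ℕ∣.*-cancelˡ-∣ d (subst (n ∣_) gcd-scaled
      (gcd-greatest (subst (n ∣_) (trans (ℤₚ.abs-* a z) (ℕₚ.*-comm ∣ a ∣ ∣ z ∣)) (exp-faithful (a * z) χz≈1))
                    (ℕ∣.n∣m*n ∣ z ∣)))
      where
      gcd-scaled : gcd (∣ z ∣ ℕ.* ∣ a ∣) (∣ z ∣ ℕ.* n) ≡ d ℕ.* ∣ z ∣
      gcd-scaled = trans (sym (c*gcd[m,n]≡gcd[cm,cn] ∣ z ∣ ∣ a ∣ n))
                         (trans (cong (∣ z ∣ ℕ.*_) gcd≡d) (ℕₚ.*-comm ∣ z ∣ d))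

    open GaussSum R m d χ χ-+ χ-mod χ-faithful (PrimRootChar0.no-zero-divisors ζ-prim) using (T; K; T-evaluation)

    aN : ℕ
    aN = a %ℕ n

    pow≈χ : ∀ t → pow (aN ℕ.* t) ≈ χ (+ t)
    pow≈χ t = exp-ℕ (aN ℕ.* t) (a * + t)
      (mod-trans (mod-reflexive (ℤₚ.pos-* aN t)) (mod-* (mod-sym (mod-residue n a)) (mod-refl {x = + t})))

  GaussSL≈T : ∀ r → GaussSL R n r aN ζ ≈ T r 1ℤ
  GaussSL≈T r = R.trans (∑-filter (λ X → ≡1mod? n (detLift X)) (allMats n r) (λ X → pow (aN ℕ.* trLift X)))
    (R.trans (∑-cong (allMats n r) pointwise)
      (R.trans (R.reflexive (sym (∑-map liftRows (allMats n r) (λ Y → δ n (1ℤ * det Y - 1ℤ) ⊛ χ (tr Y)))))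
        (R.reflexive (cong (λ l → ∑ l (λ Y → δ n (1ℤ * det Y - 1ℤ) ⊛ χ (tr Y))) (sym matrices≡)))))
    where
    matrices≡ : allVecsOf (allVecsOf (residues n) r) r ≡ map liftRows (allMats n r)
    matrices≡ = trans (cong (λ l → allVecsOf l r) (allVecsOf-map lift (allFin n) r))
                      (allVecsOf-map (Vec.map lift) (allVecsOf (allFin n) r) r)
    pointwise : ∀ X → 𝟙 (≡1mod? n (detLift X)) ⊛ pow (aN ℕ.* trLift X)
                      ≈ δ n (1ℤ * det (liftRows X) - 1ℤ) ⊛ χ (tr (liftRows X))
    pointwise X = R.*-cong
      (R.reflexive (cong (λ z → δ n (z - 1ℤ)) (trans (sym (det-lift X)) (sym (ℤₚ.*-identityˡ (det (liftRows X)))))))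
      (R.trans (pow≈χ (trLift X)) (R.reflexive (cong χ (sym (tr-lift X)))))

  Kloost≈K : ∀ r → Kloost R m r aN ζ ≈ K r 1ℤ
  Kloost≈K r = R.trans (∑-filter (λ x → ≡1mod? m (prodℤ (Vec.toList (Vec.map (λ y → + toℕ y) x)))) (allVecsOf (allFin m) r)
                         (λ x → pow (aN ℕ.* sumℕ (Vec.toList (Vec.map toℕ x)))))
    (R.trans (∑-cong (allVecsOf (allFin m) r) pointwise)
      (R.trans (R.reflexive (sym (∑-map (Vec.map lift) (allVecsOf (allFin m) r) (λ y → δ m (1ℤ * prodVec y - 1ℤ) ⊛ χ (sumVec y)))))
        (R.reflexive (cong (λ l → ∑ l (λ y → δ m (1ℤ * prodVec y - 1ℤ) ⊛ χ (sumVec y))) (sym (allVecsOf-map lift (allFin m) r))))))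
    where
    pointwise : ∀ (x : Vec (Fin m) r) →
      𝟙 (≡1mod? m (prodℤ (Vec.toList (Vec.map (λ y → + toℕ y) x)))) ⊛ pow (aN ℕ.* sumℕ (Vec.toList (Vec.map toℕ x)))
      ≈ δ m (1ℤ * prodVec (Vec.map lift x) - 1ℤ) ⊛ χ (sumVec (Vec.map lift x))
    pointwise x = R.*-cong
      (R.reflexive (cong (λ z → δ m (z - 1ℤ)) (trans (sym (prodVec≡ x)) (sym (ℤₚ.*-identityˡ (prodVec (Vec.map lift x)))))))
      (R.trans (pow≈χ (sumℕ (Vec.toList (Vec.map toℕ x)))) (R.reflexive (cong χ (sym (sumVec≡ x)))))

  evaluation : ∀ j → ι (denomP n m (suc j)) ⊛ GaussSL R n (suc j) aN ζ
    ≈ ι (n ℕ.^ ((suc j ℕ.* j) ℕ./ 2) ℕ.* d ℕ.^ ((suc j ℕ.* suc (suc j)) ℕ./ 2 ℕ.∸ 1) ℕ.* numerP n m (suc j))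
      ⊛ Kloost R m (suc j) aN ζ
  evaluation j = R.trans
    (R.*-cong (R.reflexive (cong ι (sym (denominator≡ (primesDivNotDiv n m) j)))) (GaussSL≈T (suc j)))
    (R.trans (T-evaluation j 1ℤ (1ℤ , mod-refl))
      (R.*-cong (R.reflexive (cong ι (numerator≡ n d (primesDivNotDiv n m) j))) (R.sym (Kloost≈K (suc j)))))

-- n = d m enters as an equation, so that matching on it replaces n by d m; for the gcd and its
-- cofactor in n the equation holds only propositionally.
evaluation-quotient : ∀ {c ℓ} (R : CommutativeRing c ℓ) (ζ : CommutativeRing.Carrier R) (n j : ℕ) .{{_ : NonZero n}} (a : ℤ)
  (m d : ℕ) → n ≡ d ℕ.* m → gcd ∣ a ∣ n ≡ d → PrimRootChar0 R n ζ →
  CommutativeRing._≈_ R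
    (CommutativeRing._*_ R (ιR R (denomP n m (suc j))) (GaussSL R n (suc j) (a %ℕ n) ζ))
    (CommutativeRing._*_ R
      (ιR R (n ℕ.^ ((suc j ℕ.* j) ℕ./ 2) ℕ.* d ℕ.^ ((suc j ℕ.* suc (suc j)) ℕ./ 2 ℕ.∸ 1) ℕ.* numerP n m (suc j)))
      (Kloost R m (suc j) (a %ℕ n) ζ))
evaluation-quotient R ζ _ j a m d refl gcd≡d ζ-prim =
  evaluation R ζ a m d {{ℕₚ.m*n≢0⇒n≢0 d}} {{ℕₚ.m*n≢0⇒m≢0 d}} gcd≡d ζ-prim j

theorem5 : ∀ {c ℓ} (R : CommutativeRing c ℓ) (ζ : CommutativeRing.Carrier R)
             (n r : ℕ) .{{_ : NonZero n}} → 1 ℕ.≤ r → (a : ℤ) →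
             PrimRootChar0 R n ζ →
             let d = gcd ∣ a ∣ n
                 m = quotient (gcd[m,n]∣n ∣ a ∣ n)
                 aN = a %ℕ n
             in CommutativeRing._≈_ R
                  (CommutativeRing._*_ R (ιR R (denomP n m r)) (GaussSL R n r aN ζ))
                  (CommutativeRing._*_ R
                     (ιR R (n ℕ.^ ((r ℕ.* (r ℕ.∸ 1)) ℕ./ 2) ℕ.* d ℕ.^ ((r ℕ.* suc r) ℕ./ 2 ℕ.∸ 1) ℕ.* numerP n m r))
                     (Kloost R m r aN ζ))
theorem5 R ζ n (suc j) 1≤r a ζ-prim =
  evaluation-quotient R ζ n j a (quotient g∣n) (gcd ∣ a ∣ n) (trans (ℕ∣._∣_.equality g∣n) (ℕₚ.*-comm (quotient g∣n) (gcd ∣ a ∣ n))) refl ζ-prim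
  where
  g∣n = gcd[m,n]∣n ∣ a ∣ n
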